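{- LQU$^+$-Res and IRM-calc have monotone feasible interpolation. That is, for each $S\in\{\text{LQU}^+\text{ -Res},\text{IRM-calc}\}$ there is an effective procedure which, given any $S$-refutation $\pi$ of a false QBF $\mathcal{F}=\exists \vec{p}\, \mathcal{Q}\vec{q}\, \mathcal{Q}\vec{r}.\,[A(\vec{p},\vec{q})\wedge B(\vec{p},\vec{r})]$ (with $\vec p,\vec q,\vec r$ mutually disjoint, $A$ a CNF over $\vec p,\vec q$, $B$ a CNF over $\vec p,\vec r$, the $\vec q,\vec r$ variables quantified arbitrarily), outputs a Boolean circuit $G$ with inputs $\vec p$ of size polynomial in the size of $\pi$ such that for every $0/1$ assignment $\vec a$ to $\vec p$, $G(\vec a)=0$ implies $\mathcal{Q}\vec q.\,A(\vec a,\vec q)$ is false and $G(\vec a)=1$ implies $\mathcal{Q}\vec r.\,B(\vec a,\vec r)$ is false; and moreover, if the variables $\vec p$ occur only positively in $A(\vec p,\vec q)$, then the circuit $G$ is monotone.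
   Context: QBFs are closed, prenex, with CNF matrix without tautological clauses; $\mathrm{ind}(x_i)=i$ is the position in the prefix. LQU$^+$-Res: lines are clauses possibly containing merged literals $u^*$ ($u$ universal, $\mathrm{ind}(u^*)=\mathrm{ind}(u)$). Rules: (Axiom) matrix clauses; ($\forall$-Red) from $D\vee u$ or $D\vee u^*$ ($u$ universal literal) derive $D$ if $\mathrm{ind}(u)\ge\mathrm{ind}(l)$ for all existential $l\in D$; (Res) from $C_1\vee U_1\vee x$, $C_2\vee U_2\vee\neg x$ ($x$ an existential or universal variable) derive $C_1\vee C_2\vee U$ where: literals of $C_1,C_2$ on the same variable $z$ are equal and not $z^*$; $U_1,U_2$ consist of universal literals with $\mathrm{var}(U_1)=\mathrm{var}(U_2)$, each of index greater than $\mathrm{ind}(x)$; for $w_1\in U_1,w_2\in U_2$ on the same variable $u$, $w_1=\neg w_2$ or one of them is $u^*$; $U=\{u^*:u\in\mathrm{var}(U_1)\}$. IRM-calc: clauses of annotated existential literals $l^\sigma$ ($\sigma$ a partial map from universal variables of index $<\mathrm{ind}(l)$ to $\{0,1,*\}$); $l^{[\sigma]}$ restricts $\sigma$ to variables of index $<\mathrm{ind}(l)$; $\tau\circ\mu$ takes $\tau$'s values where defined, else $\mu$'s; $\mathrm{inst}(\tau,C)=\{l^{[\sigma\circ\tau]}:l^\sigma\in C\}$. Rules: (Axiom) from matrix clause $C$ derive $\{l^{[\tau]}: l\in C \text{ existential}\}$, $\tau$ assigning each universal variable of $C$ the value falsifying its literal; (Instantiation) $C\vdash \mathrm{inst}(\tau,C)$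 for $\tau$ a $\{0,1\}$-assignment to universal variables; (Res) $x^{\tau\cup\xi}\vee C_1,\ \neg x^{\tau\cup\sigma}\vee C_2\vdash \mathrm{inst}(\sigma,C_1)\cup\mathrm{inst}(\xi,C_2)$ with mutually disjoint domains and $\mathrm{rng}(\tau)\subseteq\{0,1\}$; (Merging) $C\vee b^\mu\vee b^\sigma\vdash C\vee b^\xi$ with $\mathrm{dom}(\mu)=\mathrm{dom}(\sigma)$, $\xi$ keeping common values and putting $*/u$ where they differ. In both systems a refutation is a derivation of the empty clause, and size is the number of clauses. -}

module Defs where

open import Data.Nat using (ℕ; zero; suc; _+_; _*_; _^_; _≤_; _<_; _<ᵇ_)
open import Data.Fin using (Fin; toℕ; _≟_)
open import Data.Bool using (Bool; true; false; if_then_else_; not)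
open import Data.Maybe using (Maybe; just; nothing)
import Data.Maybe as Maybe
open import Data.List using (List; []; _∷_; _++_; length; allFin; filterᵇ)
open import Data.List.Membership.Propositional using (_∈_)
open import Data.List.Relation.Unary.All using (All)
open import Data.Vec using (Vec; lookup; tabulate; zipWith)
open import Data.Product using (Σ; _×_; _,_; proj₁)
open import Data.Sum using (_⊎_)
open import Data.Unit using (⊤)
open import Data.Empty using (⊥)
open import Relation.Nullary using (¬_; Dec; yes; no)
open import Relation.Binary.PropositionalEquality using (_≡_; _≢_)

-- QBFs.  Variables are Fin n; ind(x) = toℕ x (position in the prefix).

data Quant : Set where
  ex all : Quant

-- A (non-tautological) clause of the matrix: for each variable, either it
-- does not occur, or it occurs with a polarity (true = positive literal x,
-- false = negative literal ¬x).  A clause without complementary literals is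
-- exactly such a partial map.
MClause : ℕ → Set
MClause n = Fin n → Maybe Bool

SatClause : ∀ {n} → (Fin n → Bool) → MClause n → Set
SatClause ρ C = Σ _ λ z → C z ≡ just (ρ z)

SatCNF : ∀ {n} → (Fin n → Bool) → List (MClause n) → Set
SatCNF ρ M = All (SatClause ρ) M

update : ∀ {n} → (Fin n → Bool) → Fin n → Bool → (Fin n → Bool)
update ρ x b z with z ≟ x
... | yes _ = b
... | no _ = ρ z

Eval : ∀ {n} → (Fin n → Quant) → List (Fin n) → List (MClause n) → (Fin n → Bool) → Set
Eval quant [] M ρ = SatCNF ρ M
Eval quant (x ∷ xs) M ρ with quant x
... | ex  = Σ Bool λ b → Eval quant xs M (update ρ x b)
... | all = (b : Bool) → Eval quant xs M (update ρ x b)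

data Side : Set where
  P Q R : Side

isQ isR : Side → Bool
isQ Q = true
isQ _ = false
isR R = true
isR _ = false

record Instance : Set where
  field
    n     : ℕ
    quant : Fin n → Quant
    side  : Fin n → Side
    A     : List (MClause n)
    B     : List (MClause n)
    p-ex  : ∀ z → side z ≡ P → quant z ≡ ex
    p<qr  : ∀ z w → side z ≡ P → side w ≢ P → toℕ z < toℕ w
    q<r   : ∀ z w → side z ≡ Q → side w ≡ R → toℕ z < toℕ w
    A-vars : All (λ C → ∀ z → side z ≡ R → C z ≡ nothing) A
    B-vars : All (λ C → ∀ z → side z ≡ Q → C z ≡ nothing) B

  qVars rVars : List (Fin n)
  qVars = filterᵇ (λ z → isQ (side z)) (allFin n)
  rVars = filterᵇ (λ z → isR (side z)) (allFin n)

  matrix : List (MClause n)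
  matrix = A ++ B

  A-true : (Fin n → Bool) → Set
  A-true a = Eval quant qVars A a

  B-true : (Fin n → Bool) → Set
  B-true a = Eval quant rVars B a

  p-positive-in-A : Set
  p-positive-in-A = All (λ C → ∀ z → side z ≡ P → C z ≢ just false) A

data Gate (n m : ℕ) : Set where
  input : Fin n → Gate n m
  const : Bool → Gate n m
  neg   : Fin m → Gate n m
  and   : Fin m → Fin m → Gate n m
  or    : Fin m → Fin m → Gate n m

data Gates (n : ℕ) : ℕ → Set where
  []  : Gates n 0
  _▷_ : ∀ {m} → Gates n m → Gate n m → Gates n (suc m)

evalGate : ∀ {n m} → Gate n m → Vec Bool m → (Fin n → Bool) → Bool
evalGate (input x) v ρ = ρ x
evalGate (const b) v ρ = b
evalGate (neg i)   v ρ = not (lookup v i)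
evalGate (and i j) v ρ = Data.Bool._∧_ (lookup v i) (lookup v j)
evalGate (or i j)  v ρ = Data.Bool._∨_ (lookup v i) (lookup v j)

-- values of all gates (most recent gate first)
evalGates : ∀ {n m} → Gates n m → (Fin n → Bool) → Vec Bool m
evalGates [] ρ = Data.Vec.[]
evalGates (gs ▷ g) ρ = let v = evalGates gs ρ in evalGate g v ρ Data.Vec.∷ v

Circuit : ℕ → Set
Circuit n = Σ ℕ λ m → Gates n (suc m)

size : ∀ {n} → Circuit n → ℕ
size (m , _) = suc m

output : ∀ {n} → Circuit n → (Fin n → Bool) → Bool
output (m , gs) ρ = Data.Vec.head (evalGates gs ρ)

AllGates : ∀ {n} → (∀ {m} → Gate n m → Set) → ∀ {m} → Gates n m → Set
AllGates Pr [] = ⊤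
AllGates Pr (gs ▷ g) = AllGates Pr gs × Pr g

InputsIn : ∀ {n} → (Fin n → Set) → Circuit n → Set
InputsIn S (_ , gs) = AllGates (λ { (input x) → S x ; _ → ⊤ }) gs

Monotone : ∀ {n} → Circuit n → Set
Monotone (_ , gs) = AllGates (λ { (neg _) → ⊥ ; _ → ⊤ }) gs

-- LQU⁺-Res.  Literals: u, ¬u, u* ; a clause has at most one literal per
-- variable (an invariant of all LQU⁺-Res derivations), so it is a map
-- Fin n → Maybe Pol3.

data Pol3 : Set where
  pos negl star : Pol3

LClause : ℕ → Set
LClause n = Fin n → Maybe Pol3

toPol3 : Bool → Pol3
toPol3 true = pos
toPol3 false = negl

compat : Maybe Pol3 → Maybe Pol3 → Set
compat (just pos)  (just negl) = ⊤
compat (just negl) (just pos)  = ⊤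
compat (just star) (just _)    = ⊤
compat (just pos)  (just star) = ⊤
compat (just negl) (just star) = ⊤
compat _ _ = ⊥

agree : Maybe Pol3 → Maybe Pol3 → Set
agree nothing _ = ⊤
agree (just _) nothing = ⊤
agree (just a) (just b) = (a ≡ b) × (a ≢ star)

merge : Maybe Pol3 → Maybe Pol3 → Maybe Pol3
merge nothing m = m
merge (just a) _ = just a

module _ (F : Instance) where
  open Instance F

  data LQStep (ls : List (LClause n)) : LClause n → Set where
    axiom : ∀ {D} (C : MClause n) → C ∈ matrix →
            (∀ z → D z ≡ Maybe.map toPol3 (C z)) → LQStep ls D
    ∀-red : ∀ {D} (C : LClause n) (u : Fin n) → C ∈ ls →
            quant u ≡ all → C u ≢ nothing →
            (∀ z → quant z ≡ ex → C z ≢ nothing → toℕ z ≤ toℕ u) →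
            D u ≡ nothing → (∀ z → z ≢ u → D z ≡ C z) → LQStep ls D
    res   : ∀ {D} (C₁ C₂ : LClause n) (x : Fin n) (V : Fin n → Bool) →
            C₁ ∈ ls → C₂ ∈ ls →
            C₁ x ≡ just pos → C₂ x ≡ just negl → D x ≡ nothing →
            -- variables of U = U₁ = U₂
            (∀ z → V z ≡ true → (quant z ≡ all) × (toℕ x < toℕ z) ×
                                 compat (C₁ z) (C₂ z) × (D z ≡ just star)) →
            (∀ z → z ≢ x → V z ≡ false →
                  agree (C₁ z) (C₂ z) × (D z ≡ merge (C₁ z) (C₂ z))) →
            LQStep ls D

  data LQDeriv : List (LClause n) → Set where
    []  : LQDeriv []
    _∷_ : ∀ {ls D} → LQStep ls D → LQDeriv ls → LQDeriv (D ∷ ls)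

  LQEndsEmpty : List (LClause n) → Set
  LQEndsEmpty [] = ⊥
  LQEndsEmpty (D ∷ _) = ∀ z → D z ≡ nothing

  LQRefutation : Set
  LQRefutation = Σ (List (LClause n)) λ ls → LQDeriv ls × LQEndsEmpty ls

data AV : Set where
  a0 a1 a* : AV

_==AV_ : AV → AV → Bool
a0 ==AV a0 = true
a1 ==AV a1 = true
a* ==AV a* = true
_  ==AV _  = false

Ann : ℕ → Set
Ann n = Vec (Maybe AV) n

-- annotated literal  l^σ : variable, polarity (true = positive), annotation
record ALit (n : ℕ) : Set where
  constructor mkLit
  field
    var : Fin n
    pol : Bool
    ann : Ann n

AClause : ℕ → Set
AClause n = List (ALit n)

restrict : ∀ {n} → Fin n → Ann n → Ann n
restrict x σ = tabulate λ z → if toℕ z <ᵇ toℕ x then lookup σ z else nothing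

compose : ∀ {n} → Ann n → Ann n → Ann n
compose = zipWith λ { (just a) _ → just a ; nothing m → m }

instLit : ∀ {n} → Ann n → ALit n → ALit n
instLit τ (mkLit x p σ) = mkLit x p (restrict x (compose σ τ))

mergeAnn : ∀ {n} → Ann n → Ann n → Ann n
mergeAnn = zipWith λ { (just a) (just b) → just (if a ==AV b then a else a*)
                     ; _ _ → nothing }

sameDom : Maybe AV → Maybe AV → Set
sameDom nothing nothing = ⊤
sameDom (just _) (just _) = ⊤
sameDom _ _ = ⊥

-- clause E has exactly the members described by S (clauses are sets)
SameSet : ∀ {n} → AClause n → (ALit n → Set) → Set
SameSet E S = ∀ l → (l ∈ E → S l) × (S l → l ∈ E)

bitOf : Bool → AV
bitOf false = a0
bitOf true = a1

module _ (F : Instance) where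
  open Instance F

  -- τ assigning each universal variable of C the value falsifying its literal
  axAnn : MClause n → Ann n
  axAnn C = tabulate λ z → axv (quant z) (C z)
    where
    axv : Quant → Maybe Bool → Maybe AV
    axv all (just b) = just (bitOf (not b))
    axv _ _ = nothing

  Disjoint : Ann n → Ann n → Set
  Disjoint σ τ = ∀ z → (lookup σ z ≡ nothing) ⊎ (lookup τ z ≡ nothing)

  data IRMStep (ls : List (AClause n)) : AClause n → Set where
    axiom : ∀ {E} (C : MClause n) → C ∈ matrix →
            SameSet E (λ l → Σ (Fin n) λ z → Σ Bool λ b →
               (quant z ≡ ex) × (C z ≡ just b) × (l ≡ mkLit z b (restrict z (axAnn C)))) →
            IRMStep ls E
    inst  : ∀ {E} (D : AClause n) (τ : Ann n) → D ∈ ls →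
            (∀ z → lookup τ z ≢ nothing → quant z ≡ all) →
            (∀ z → lookup τ z ≢ just a*) →
            SameSet E (λ l → Σ (ALit n) λ l' → (l' ∈ D) × (l ≡ instLit τ l')) →
            IRMStep ls E
    res   : ∀ {E} (D₁ D₂ : AClause n) (x : Fin n) (τ ξ σ : Ann n) →
            D₁ ∈ ls → D₂ ∈ ls →
            mkLit x true  (compose τ ξ) ∈ D₁ →
            mkLit x false (compose τ σ) ∈ D₂ →
            Disjoint τ ξ → Disjoint τ σ → Disjoint ξ σ →
            (∀ z → lookup τ z ≢ just a*) →
            SameSet E (λ l →
              (Σ (ALit n) λ l' → (l' ∈ D₁) × (l' ≢ mkLit x true (compose τ ξ)) × (l ≡ instLit σ l'))
              ⊎ (Σ (ALit n) λ l' → (l' ∈ D₂) × (l' ≢ mkLit x false (compose τ σ)) × (l ≡ instLit ξ l'))) →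
            IRMStep ls E
    merging : ∀ {E} (D : AClause n) (b : Fin n) (p : Bool) (μ σ : Ann n) →
            D ∈ ls → mkLit b p μ ∈ D → mkLit b p σ ∈ D →
            (∀ z → sameDom (lookup μ z) (lookup σ z)) →
            SameSet E (λ l →
              ((l ∈ D) × (l ≢ mkLit b p μ) × (l ≢ mkLit b p σ))
              ⊎ (l ≡ mkLit b p (mergeAnn μ σ))) →
            IRMStep ls E

  data IRMDeriv : List (AClause n) → Set where
    []  : IRMDeriv []
    _∷_ : ∀ {ls E} → IRMStep ls E → IRMDeriv ls → IRMDeriv (E ∷ ls)

  IRMEndsEmpty : List (AClause n) → Set
  IRMEndsEmpty [] = ⊥
  IRMEndsEmpty (E ∷ _) = E ≡ []

  IRMRefutation : Set
  IRMRefutation = Σ (List (AClause n)) λ ls → IRMDeriv ls × IRMEndsEmpty ls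

data System : Set where
  LQU⁺-Res IRM-calc : System

Refutation : System → Instance → Set
Refutation LQU⁺-Res F = LQRefutation F
Refutation IRM-calc F = IRMRefutation F

refSize : ∀ {S F} → Refutation S F → ℕ
refSize {LQU⁺-Res} (ls , _) = length ls
refSize {IRM-calc} (ls , _) = length ls

-- Monotone feasible interpolation for S: an (Agda-definable, hence
-- effective) procedure mapping refutations to circuits in the p variables,
-- of size polynomial (c·s^k + c) in the refutation size s, such that ...
MonotoneFeasibleInterpolation : System → Set
MonotoneFeasibleInterpolation S =
  Σ ℕ λ c → Σ ℕ λ k →
  Σ ((F : Instance) → Refutation S F → Circuit (Instance.n F)) λ interp →
  (F : Instance) → (π : Refutation S F) →
    let open Instance F
        G = interp F π
    in (size G ≤ c * refSize {S} {F} π ^ k + c)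
     × InputsIn (λ z → side z ≡ P) G
     × (∀ a → output G a ≡ false → ¬ A-true a)
     × (∀ a → output G a ≡ true  → ¬ B-true a)
     × (p-positive-in-A → Monotone G)

-- Every line gets a bit: 0 on axioms from A, 1 on axioms from B; a resolution step computes ∨ on a
-- q-pivot, ∧ on an r-pivot, and on a p-pivot selects the premise whose pivot literal is false.  If
-- no p occurs negatively in A, a premise with bit 0 may be used even when its literal ¬p is true,
-- so (p ∨ g₁) ∧ g₂ is an admissible selector.
--
-- Fix p = a and a winning strategy of the existential player for A(a,q) (or B(a,r)).  Whenever a
-- line has bit 0 (or 1) and its p-literals are refuted, the rest of the line is valid against the
-- strategy once its starred values are read as answers of the universal player that depend only on
-- preceding variables.  For LQU⁺-Res, z* means z ≠ f(preceding variables).  For IRM-calc, there is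
-- a partial strategy of the universal player such that every play following it makes a literal
-- true whose annotation agrees with the moves prescribed.  The empty clause is never valid.

module Submission where

open import Defs
open import Data.Bool using (Bool; true; false; if_then_else_; not; _∧_; _∨_)
open import Data.Bool.Properties using (∧-idem; ∧-zeroʳ; ∧-identityʳ; ¬-not; not-¬; T?; T-≡)
  renaming (_≟_ to _≟ᵇ_)
open import Data.Empty using (⊥; ⊥-elim)
open import Data.Fin using (Fin; zero; suc; toℕ; fromℕ<; _≟_)
open import Data.Fin.Properties using (toℕ-injective; toℕ<n; fromℕ<-toℕ; toℕ-fromℕ<; all?)
open import Data.List using (List; []; _∷_; length; allFin; filterᵇ)
open import Data.List.Membership.Propositional using (_∈_; _∉_)
open import Data.List.Membership.Propositional.Properties
  using (∈-++⁻; ∈-filter⁺; ∈-filter⁻; ∈-allFin)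
open import Data.List.Relation.Unary.All as All using (All; []; _∷_)
open import Data.List.Relation.Unary.AllPairs using (AllPairs; []; _∷_)
import Data.List.Relation.Unary.AllPairs.Properties as AllPairs
open import Data.List.Relation.Unary.Any using (here; there; index)
open import Data.Maybe as Maybe using (Maybe; just; nothing; _<∣>_)
open import Data.Maybe.Properties using (just-injective) renaming (≡-dec to maybe-≡-dec)
open import Data.Nat using (ℕ; zero; suc; _+_; _*_; _^_; _≤_; _<_; z≤n; s≤s; _<?_)
open import Data.Nat.Properties
  using (≤-refl; ≤-reflexive; <⇒≤; <-trans; <-≤-trans; <-irrefl; <⇒<ᵇ; m≤n⇒m<n∨m≡n; n<1+n; <-cmp;
         ≤-pred; +-mono-≤; +-assoc; +-comm; *-comm; ^-identityʳ; module ≤-Reasoning)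
open import Data.Product using (Σ; _×_; _,_; proj₁; proj₂)
open import Data.Sum using (_⊎_; inj₁; inj₂)
open import Data.Unit using (⊤; tt)
open import Data.Vec using ([]; _∷_; lookup)
open import Data.Vec.Properties using (lookup∘tabulate) renaming (≡-dec to vec-≡-dec)
open import Function using (_∘_)
open import Function.Bundles using (Equivalence)
open import Relation.Binary.Definitions using (DecidableEquality; tri<; tri≈; tri>)
open import Relation.Binary.PropositionalEquality
  using (_≡_; _≢_; refl; sym; trans; cong; cong₂; subst)
open import Relation.Nullary using (¬_; Dec; yes; no; does; contradiction)
open import Relation.Nullary.Decidable using (_×-dec_; _→-dec_; ¬?; dec-true; map′)

-- Assignments and dependence on preceding variables

Assignment : ℕ → Set
Assignment n = Fin n → Bool

AgreeBelow : ∀ {n} → Fin n → Assignment n → Assignment n → Set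
AgreeBelow z υ υ′ = ∀ w → toℕ w < toℕ z → υ w ≡ υ′ w

Local : ∀ {n} {X : Set} → Fin n → (Assignment n → X) → Set
Local z f = ∀ {υ υ′} → AgreeBelow z υ υ′ → f υ ≡ f υ′

agreeBelow-≤ : ∀ {n} {w z : Fin n} {υ υ′} → toℕ w ≤ toℕ z → AgreeBelow z υ υ′ → AgreeBelow w υ υ′
agreeBelow-≤ w≤z agr v v<w = agr v (<-≤-trans v<w w≤z)

update-same : ∀ {n} (ρ : Assignment n) x b → update ρ x b x ≡ b
update-same ρ x b with x ≟ x
... | yes _  = refl
... | no x≢x = contradiction refl x≢x

update-other : ∀ {n} (ρ : Assignment n) x b {z} → z ≢ x → update ρ x b z ≡ ρ z
update-other ρ x b {z} z≢x with z ≟ x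
... | yes z≡x = contradiction z≡x z≢x
... | no _    = refl

ex≢all : ∀ {q} → q ≡ ex → q ≡ all → ⊥
ex≢all refl ()

-- Winning strategies of the existential player

Ascending : ∀ {n} → List (Fin n) → Set
Ascending = AllPairs (λ x y → toℕ x < toℕ y)

module _ {n} (quant : Fin n → Quant) where

  -- υ holds the moves of the universal player; play υ is the resulting assignment.
  record Skolem (xs : List (Fin n)) (M : List (MClause n)) (ρ : Assignment n) : Set where
    field
      play   : Assignment n → Assignment n
      wins   : ∀ υ → SatCNF (play υ) M
      frame  : ∀ υ {z} → z ∉ xs → play υ z ≡ ρ z
      play-∀ : ∀ υ {z} → z ∈ xs → quant z ≡ all → play υ z ≡ υ z
      play-∃ : ∀ {z} → quant z ≡ ex → Local z (λ υ → play υ z)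

  open Skolem

  -- Induction along the prefix. A universal move `υ x` selects the strategy for the rest; locality
  -- survives because `Ascending` puts every variable of `xs` behind `x`, and an existential
  -- variable outside `xs` keeps its value in `ρ`.
  skolem : ∀ {xs M ρ} → Ascending xs → Eval quant xs M ρ → Skolem xs M ρ
  skolem {[]} [] sat = record
    { play = λ _ → _ ; wins = λ _ → sat ; frame = λ _ _ → refl
    ; play-∀ = λ _ () ; play-∃ = λ _ _ → refl }
  skolem {x ∷ xs} {M} {ρ} (x<xs ∷ asc) e with quant x in qx
  ... | ex = record
    { play   = play S
    ; wins   = wins S
    ; frame  = λ υ z∉ → trans (frame S υ (z∉ ∘ there)) (update-other ρ x _ (z∉ ∘ here))
    ; play-∀ = λ { υ (here refl) q∀ → ⊥-elim (ex≢all qx q∀) ; υ (there z∈) q∀ → play-∀ S υ z∈ q∀ }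
    ; play-∃ = play-∃ S }
    where S = skolem asc (proj₂ e)
  ... | all = record
    { play   = λ υ → play (S (υ x)) υ
    ; wins   = λ υ → wins (S (υ x)) υ
    ; frame  = λ υ z∉ → trans (frame (S (υ x)) υ (z∉ ∘ there)) (update-other ρ x _ (z∉ ∘ here))
    ; play-∀ = λ { υ (here refl) _ → trans (frame (S (υ x)) υ x∉xs) (update-same ρ x (υ x))
                 ; υ (there z∈) q∀ → play-∀ (S (υ x)) υ z∈ q∀ }
    ; play-∃ = local }
    where
    S : ∀ b → Skolem xs M (update ρ x b)
    S b = skolem asc (e b)
    x∉xs : x ∉ xs
    x∉xs x∈ = <-irrefl refl (All.lookup x<xs x∈)
    open import Data.List.Membership.DecPropositional (_≟_ {n}) using (_∈?_)
    local : ∀ {z} → quant z ≡ ex → Local z (λ υ → play (S (υ x)) υ z)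
    local {z} q∃ {υ} {υ′} agr with z ∈? xs
    ... | yes z∈ = trans (cong (λ b → play (S b) υ z) (agr x (All.lookup x<xs z∈)))
                         (play-∃ (S (υ′ x)) q∃ agr)
    ... | no z∉  = trans (unchanged υ) (sym (unchanged υ′))
      where
      unchanged : ∀ υ → play (S (υ x)) υ z ≡ ρ z
      unchanged υ = trans (frame (S (υ x)) υ z∉)
                          (update-other ρ x _ λ { refl → ex≢all q∃ qx })

-- v = false stands for the A-part and v = true for the B-part, as in the output of the interpolant.
ownSide : Bool → Side
ownSide false = Q
ownSide true  = R

isOwn : Bool → Side → Bool
isOwn false = isQ
isOwn true  = isR

isOwn-sound : ∀ v {s} → isOwn v s ≡ true → s ≡ ownSide v
isOwn-sound false {Q} _ = refl
isOwn-sound true  {R} _ = refl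

isOwn-complete : ∀ v {s} → s ≡ ownSide v → isOwn v s ≡ true
isOwn-complete false refl = refl
isOwn-complete true  refl = refl

_≟ˢ_ : DecidableEquality Side
P ≟ˢ P = yes refl
P ≟ˢ Q = no λ ()
P ≟ˢ R = no λ ()
Q ≟ˢ P = no λ ()
Q ≟ˢ Q = yes refl
Q ≟ˢ R = no λ ()
R ≟ˢ P = no λ ()
R ≟ˢ Q = no λ ()
R ≟ˢ R = yes refl

P≢ownSide : ∀ v {s} → s ≡ P → s ≢ ownSide v
P≢ownSide false refl ()
P≢ownSide true  refl ()

ownCNF : (F : Instance) → Bool → List (MClause (Instance.n F))
ownCNF F false = Instance.A F
ownCNF F true  = Instance.B F

ownVars : (F : Instance) → Bool → List (Fin (Instance.n F))
ownVars F v = filterᵇ (λ z → isOwn v (Instance.side F z)) (allFin (Instance.n F))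

record Winning (F : Instance) (a : Assignment (Instance.n F)) (v : Bool) : Set where
  open Instance F
  field
    play   : Assignment n → Assignment n
    wins   : ∀ υ → SatCNF (play υ) (ownCNF F v)
    play-P : ∀ υ {z} → side z ≡ P → play υ z ≡ a z
    play-∀ : ∀ υ {z} → side z ≡ ownSide v → quant z ≡ all → play υ z ≡ υ z
    play-∃ : ∀ {z} → quant z ≡ ex → Local z (λ υ → play υ z)

-- Filtering `allFin n` preserves the prefix order, which gives `Ascending`. For the two values of
-- `v`, `ownVars F v` unfolds to `qVars` and `rVars`, so the hypothesis is `A-true a` or `B-true a`.
winning : ∀ F a v → Eval (Instance.quant F) (ownVars F v) (ownCNF F v) a → Winning F a v
winning F a v e = record
  { play   = play
  ; wins   = wins
  ; play-P = λ υ sP → frame υ λ z∈ → P≢ownSide v sP (own z∈)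
  ; play-∀ = λ υ s≡ → play-∀ υ (mem s≡)
  ; play-∃ = play-∃ }
  where
  open Instance F
  own? = λ z → T? (isOwn v (side z))
  own : ∀ {z} → z ∈ ownVars F v → side z ≡ ownSide v
  own z∈ = isOwn-sound v (Equivalence.to T-≡ (proj₂ (∈-filter⁻ own? {xs = allFin n} z∈)))
  mem : ∀ {z} → side z ≡ ownSide v → z ∈ ownVars F v
  mem {z} s≡ = ∈-filter⁺ own? (∈-allFin z) (Equivalence.from T-≡ (isOwn-complete v s≡))
  open Skolem (skolem quant (AllPairs.filter⁺ own? (AllPairs.tabulate⁺-< λ i<j → i<j)) e)

-- Circuits of straight-line programs

-- The restrictions on the interpolant are built into the constructors: inputs are p-variables, and
-- negation exists only when `mono` is `false`. Monotonicity of the circuit is then a matter of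
-- typing.
data Formula (F : Instance) (mono : Bool) (k : ℕ) : Set where
  wire  : Fin k → Formula F mono k
  const : Bool → Formula F mono k
  input : (x : Fin (Instance.n F)) → Instance.side F x ≡ P → Formula F mono k
  neg   : mono ≡ false → Formula F mono k → Formula F mono k
  and   : Formula F mono k → Formula F mono k → Formula F mono k
  or    : Formula F mono k → Formula F mono k → Formula F mono k

data Program (F : Instance) (mono : Bool) : ℕ → Set where
  []  : Program F mono 0
  _▷_ : ∀ {k} → Program F mono k → Formula F mono k → Program F mono (suc k)

module _ {F : Instance} {mono : Bool} where
  open Instance F using (n; side)

  evalFormula : ∀ {k} → Formula F mono k → Assignment n → (Fin k → Bool) → Bool
  evalFormula (wire i)    a val = val i
  evalFormula (const b)   a val = b
  evalFormula (input x _) a val = a x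
  evalFormula (neg _ f)   a val = not (evalFormula f a val)
  evalFormula (and f g)   a val = evalFormula f a val ∧ evalFormula g a val
  evalFormula (or f g)    a val = evalFormula f a val ∨ evalFormula g a val

  evalProgram : ∀ {k} → Program F mono k → Assignment n → Fin k → Bool
  evalProgram (p ▷ f) a zero    = evalFormula f a (evalProgram p a)
  evalProgram (p ▷ f) a (suc i) = evalProgram p a i

  evalFormula-cong : ∀ {k} (f : Formula F mono k) a {val val′} →
                     (∀ i → val i ≡ val′ i) → evalFormula f a val ≡ evalFormula f a val′
  evalFormula-cong (wire i)    a eq = eq i
  evalFormula-cong (const b)   a eq = refl
  evalFormula-cong (input x _) a eq = refl
  evalFormula-cong (neg _ f)   a eq = cong not (evalFormula-cong f a eq)
  evalFormula-cong (and f g)   a eq = cong₂ _∧_ (evalFormula-cong f a eq) (evalFormula-cong g a eq)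
  evalFormula-cong (or f g)    a eq = cong₂ _∨_ (evalFormula-cong f a eq) (evalFormula-cong g a eq)

  cost : ∀ {k} → Formula F mono k → ℕ
  cost (wire _)    = 0
  cost (const _)   = 1
  cost (input _ _) = 1
  cost (neg _ f)   = suc (cost f)
  cost (and f g)   = suc (cost g + cost f)
  cost (or f g)    = suc (cost g + cost f)

  Allowed : ∀ {m} → Gate n m → Set
  Allowed (input x) = side x ≡ P
  Allowed (neg _)   = mono ≡ false
  Allowed _         = ⊤

  -- Each new gate shifts the positions of the old ones, which `embed` tracks. The width is a field
  -- with an equation, so that sums of costs require no transport of gate lists.
  record Extension {m} (gs : Gates n m) (c : ℕ) (val : Assignment n → Bool) : Set where
    field
      {width} : ℕ
      width-≡ : width ≡ c + m
      gates   : Gates n width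
      root    : Fin width
      embed   : Fin m → Fin width
      root-≡  : ∀ a → lookup (evalGates gates a) root ≡ val a
      embed-≡ : ∀ a i → lookup (evalGates gates a) (embed i) ≡ lookup (evalGates gs a) i
      allowed : AllGates Allowed gs → AllGates Allowed gates

  open Extension

  extend-by : ∀ {m c val₀ val} {gs : Gates n m} (e : Extension gs c val₀) (g : Gate n (width e)) →
              Allowed g → (∀ a → evalGate g (evalGates (gates e) a) a ≡ val a) →
              Extension gs (suc c) val
  extend-by e g ok eq = record
    { width-≡ = cong suc (width-≡ e)
    ; gates   = gates e ▷ g
    ; root    = zero
    ; embed   = suc ∘ embed e
    ; root-≡  = eq
    ; embed-≡ = embed-≡ e
    ; allowed = λ ags → allowed e ags , ok }

  chain : ∀ {m c d val₀ val} {gs : Gates n m} (e : Extension gs c val₀) →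
          Extension (gates e) d val → Extension gs (d + c) val
  chain {c = c} {d} e e′ = record
    { width-≡ = trans (width-≡ e′) (trans (cong (d +_) (width-≡ e)) (sym (+-assoc d c _)))
    ; gates   = gates e′
    ; root    = root e′
    ; embed   = embed e′ ∘ embed e
    ; root-≡  = root-≡ e′
    ; embed-≡ = λ a i → trans (embed-≡ e′ a (embed e i)) (embed-≡ e a i)
    ; allowed = allowed e′ ∘ allowed e }

  chain-old : ∀ {m c d val₀ val} {gs : Gates n m} (e : Extension gs c val₀)
              (e′ : Extension (gates e) d val) a →
              lookup (evalGates (gates e′) a) (embed e′ (root e)) ≡ val₀ a
  chain-old e e′ a = trans (embed-≡ e′ a (root e)) (root-≡ e a)

  current : ∀ {m} (gs : Gates n m) i → Extension gs 0 (λ a → lookup (evalGates gs a) i)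
  current gs i = record
    { width-≡ = refl ; gates = gs ; root = i ; embed = λ j → j
    ; root-≡ = λ _ → refl ; embed-≡ = λ _ _ → refl ; allowed = λ ags → ags }

  singleGate : ∀ {m val} (gs : Gates n m) (g : Gate n m) → Allowed g →
               (∀ a → evalGate g (evalGates gs a) a ≡ val a) → Extension gs 1 val
  singleGate gs g ok eq = record
    { width-≡ = refl ; gates = gs ▷ g ; root = zero ; embed = suc
    ; root-≡ = eq ; embed-≡ = λ _ _ → refl ; allowed = λ ags → ags , ok }

  compileFormula : ∀ {k m} (gs : Gates n m) (w : Fin k → Fin m) (f : Formula F mono k) →
                   Extension gs (cost f) (λ a → evalFormula f a (λ i → lookup (evalGates gs a) (w i)))
  compileBoth : ∀ {k m} (gs : Gates n m) (w : Fin k → Fin m) (f g : Formula F mono k) →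
                Σ (Extension gs (cost f) (λ a → evalFormula f a (λ i → lookup (evalGates gs a) (w i)))) λ e →
                Extension (gates e) (cost g) (λ a → evalFormula g a (λ i → lookup (evalGates gs a) (w i)))

  compileFormula gs w (wire i)     = current gs (w i)
  compileFormula gs w (const b)    = singleGate gs (const b) tt (λ _ → refl)
  compileFormula gs w (input x sP) = singleGate gs (input x) sP (λ _ → refl)
  compileFormula gs w (neg ok f)   =
    let e = compileFormula gs w f in
    extend-by e (neg (root e)) ok (λ a → cong not (root-≡ e a))
  compileFormula gs w (and f g)    =
    let e , e′ = compileBoth gs w f g in
    extend-by (chain e e′) (and (embed e′ (root e)) (root e′)) tt
              (λ a → cong₂ _∧_ (chain-old e e′ a) (root-≡ e′ a))
  compileFormula gs w (or f g)     =
    let e , e′ = compileBoth gs w f g in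
    extend-by (chain e e′) (or (embed e′ (root e)) (root e′)) tt
              (λ a → cong₂ _∨_ (chain-old e e′ a) (root-≡ e′ a))

  -- `g` is compiled on top of the gates of `f`, where the old wires still carry the same values;
  -- the record restates its value over `gs`.
  compileBoth gs w f g = e , record
    { width-≡ = width-≡ e′ ; gates = gates e′ ; root = root e′ ; embed = embed e′
    ; root-≡ = λ a → trans (root-≡ e′ a) (evalFormula-cong g a (λ i → embed-≡ e a (w i)))
    ; embed-≡ = embed-≡ e′ ; allowed = allowed e′ }
    where
    e  = compileFormula gs w f
    e′ = compileFormula (gates e) (embed e ∘ w) g

  totalCost : ∀ {k} → Program F mono k → ℕ
  totalCost []      = 0
  totalCost (p ▷ f) = cost f + totalCost p

  record Compiled {k} (p : Program F mono k) : Set where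
    field
      {width} : ℕ
      width-≡ : width ≡ totalCost p
      gates   : Gates n width
      wires   : Fin k → Fin width
      wires-≡ : ∀ a i → lookup (evalGates gates a) (wires i) ≡ evalProgram p a i
      allowed : AllGates Allowed gates

  compile : ∀ {k} (p : Program F mono k) → Compiled p
  compile [] = record
    { width-≡ = refl ; gates = [] ; wires = λ () ; wires-≡ = λ _ () ; allowed = tt }
  compile (p ▷ f) = record
    { width-≡ = trans (width-≡ e) (cong (cost f +_) (Compiled.width-≡ c))
    ; gates   = gates e
    ; wires   = λ { zero → root e ; (suc i) → embed e (Compiled.wires c i) }
    ; wires-≡ = λ { a zero    → trans (root-≡ e a) (evalFormula-cong f a (Compiled.wires-≡ c a))
                  ; a (suc i) → trans (embed-≡ e a (Compiled.wires c i)) (Compiled.wires-≡ c a i) }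
    ; allowed = allowed e (Compiled.allowed c) }
    where
    c = compile p
    e = compileFormula (Compiled.gates c) (Compiled.wires c) f

  -- The output of a circuit is its newest gate, whereas the last line of a program may be a mere
  -- wire to an older gate. Conjoining the wire with itself brings its value to the head without a
  -- negation.
  circuit : ∀ {k} → Program F mono (suc k) → Circuit n
  circuit p = Compiled.width c , Compiled.gates c ▷ and (Compiled.wires c zero) (Compiled.wires c zero)
    where c = compile p

  circuit-size : ∀ {k} (p : Program F mono (suc k)) → size (circuit p) ≡ suc (totalCost p)
  circuit-size p = cong suc (Compiled.width-≡ (compile p))

  circuit-output : ∀ {k} (p : Program F mono (suc k)) a → output (circuit p) a ≡ evalProgram p a zero
  circuit-output p a = trans (∧-idem _) (Compiled.wires-≡ (compile p) a zero)

  allGates-map : ∀ {Pr Pr′ : ∀ {m} → Gate n m → Set} → (∀ {m} (g : Gate n m) → Pr g → Pr′ g) →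
                 ∀ {m} (gs : Gates n m) → AllGates Pr gs → AllGates Pr′ gs
  allGates-map h []       _          = tt
  allGates-map h (gs ▷ g) (ags , ag) = allGates-map h gs ags , h g ag

  circuit-inputs : ∀ {k} (p : Program F mono (suc k)) → InputsIn (λ z → side z ≡ P) (circuit p)
  circuit-inputs p = allGates-map
    (λ { (input x) sP → sP ; (const _) _ → tt ; (neg _) _ → tt ; (and _ _) _ → tt ; (or _ _) _ → tt })
    (proj₂ (circuit p)) (Compiled.allowed (compile p) , tt)

  circuit-monotone : mono ≡ true → ∀ {k} (p : Program F mono (suc k)) → Monotone (circuit p)
  circuit-monotone refl p = allGates-map
    (λ { (input x) _ → tt ; (const _) _ → tt ; (neg _) () ; (and _ _) _ → tt ; (or _ _) _ → tt })
    (proj₂ (circuit p)) (Compiled.allowed (compile p) , tt)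

-- The bit of a line

module _ (F : Instance) where
  open Instance F

  axiomFormula : ∀ {mono k C} → C ∈ matrix → Formula F mono k
  axiomFormula C∈ with ∈-++⁻ A C∈
  ... | inj₁ _ = const false
  ... | inj₂ _ = const true

  -- Wire `i` belongs to the premise with the positive pivot literal. The side is passed as `s` with
  -- an equation so that proofs can split on it.
  pivotFormula : ∀ {mono k} x s → side x ≡ s → Fin k → Fin k → Formula F mono k
  pivotFormula x Q _  i j = or (wire i) (wire j)
  pivotFormula x R _  i j = and (wire i) (wire j)
  pivotFormula {true}  x P sP i j = and (or (input x sP) (wire i)) (wire j)
  pivotFormula {false} x P sP i j =
    and (or (input x sP) (wire i)) (or (neg refl (input x sP)) (wire j))

  resolveFormula : ∀ {mono k} → Fin n → Fin k → Fin k → Formula F mono k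
  resolveFormula x = pivotFormula x (side x) refl

  cost-axiom : ∀ {mono k C} (C∈ : C ∈ matrix) → cost (axiomFormula {mono} {k} C∈) ≤ 6
  cost-axiom C∈ with ∈-++⁻ A C∈
  ... | inj₁ _ = s≤s z≤n
  ... | inj₂ _ = s≤s z≤n

  -- The bound is attained by the selector with negation: two inputs, one negation, two disjunctions
  -- and one conjunction.
  cost-pivot : ∀ {mono k} x s (sx : side x ≡ s) (i j : Fin k) → cost (pivotFormula {mono} x s sx i j) ≤ 6
  cost-pivot x Q _  i j = s≤s z≤n
  cost-pivot x R _  i j = s≤s z≤n
  cost-pivot {true}  x P sP i j = s≤s (s≤s (s≤s z≤n))
  cost-pivot {false} x P sP i j = ≤-refl

  -- This gives both modes one expression: in the monotone mode the negated input degenerates to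
  -- `false`.
  eval-pivot-P : ∀ {mono k} x (sP : side x ≡ P) (i j : Fin k) a val →
                 evalFormula (pivotFormula {mono} x P sP i j) a val
                   ≡ (a x ∨ val i) ∧ ((not (a x) ∧ not mono) ∨ val j)
  eval-pivot-P {true}  x sP i j a val = cong (λ b → (a x ∨ val i) ∧ (b ∨ val j)) (sym (∧-zeroʳ (not (a x))))
  eval-pivot-P {false} x sP i j a val = cong (λ b → (a x ∨ val i) ∧ (b ∨ val j)) (sym (∧-identityʳ (not (a x))))

-- With `m` true and `b` false the value is `g₁ ∧ g₂`. If it is false because of `g₂` alone, the
-- second premise is used although its pivot literal is true; only this case produces
-- `v ≡ false × m ≡ true`.
selector-split : ∀ b m g₁ g₂ v → (b ∨ g₁) ∧ ((not b ∧ not m) ∨ g₂) ≡ v →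
                 (b ≡ false × g₁ ≡ v) ⊎ ((b ≡ true ⊎ (v ≡ false × m ≡ true)) × g₂ ≡ v)
selector-split true  _     _     _     _    eq   = inj₂ (inj₁ refl , eq)
selector-split false _     false _     _    eq   = inj₁ (refl , eq)
selector-split false false true  _     _    eq   = inj₁ (refl , eq)
selector-split false true  true  true  _    eq   = inj₁ (refl , eq)
selector-split false true  true  false _    refl = inj₂ (inj₂ (refl , refl) , refl)

∧-split : ∀ {g₁ g₂ v} → g₁ ∧ g₂ ≡ v → g₁ ≡ v ⊎ g₂ ≡ v
∧-split {false} eq = inj₁ eq
∧-split {true}  eq = inj₂ eq

∨-split : ∀ {g₁ g₂ v} → g₁ ∨ g₂ ≡ v → g₁ ≡ v ⊎ g₂ ≡ v
∨-split {true}  eq = inj₁ eq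
∨-split {false} eq = inj₂ eq

∧-true : ∀ {g₁ g₂} → g₁ ∧ g₂ ≡ true → g₁ ≡ true × g₂ ≡ true
∧-true {true} eq = refl , eq

∨-false : ∀ {g₁ g₂} → g₁ ∨ g₂ ≡ false → g₁ ≡ false × g₂ ≡ false
∨-false {false} eq = refl , eq

-- Refuted p-literals and the premises selected by a bit

module Invariant {F : Instance} {mono : Bool} {a : Assignment (Instance.n F)} {v : Bool}
                 (W : Winning F a v) (positive : mono ≡ true → Instance.p-positive-in-A F) where
  open Instance F
  open Winning W

  -- A negative p-literal counts as refuted, whatever its value, when such literals
  -- cannot occur in the axioms of the part considered.
  Refuted : Bool → Fin n → Set
  Refuted true  z = a z ≡ false
  Refuted false z = a z ≡ true ⊎ (v ≡ false × mono ≡ true)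

  refuted-satisfied : ∀ {b z} → a z ≡ b → Refuted b z → b ≡ false × v ≡ false × mono ≡ true
  refuted-satisfied {true}  eq r = contradiction (trans (sym eq) r) λ ()
  refuted-satisfied {false} eq (inj₁ r) = contradiction (trans (sym eq) r) λ ()
  refuted-satisfied {false} eq (inj₂ r) = refl , r

  axiom-own : ∀ {k C} (C∈ : C ∈ matrix) {val : Fin k → Bool} →
              evalFormula (axiomFormula F {mono = mono} C∈) a val ≡ v → C ∈ ownCNF F v
  axiom-own C∈ eq with ∈-++⁻ A C∈ | eq
  ... | inj₁ C∈A | refl = C∈A
  ... | inj₂ C∈B | refl = C∈B

  -- The winning play satisfies some literal of the clause. Variables of the other part do not occur
  -- in it. A true p-literal that counts as refuted would be negative and in `A`, with `mono` true,
  -- against `positive`.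
  axiom-witness : ∀ {C} → C ∈ ownCNF F v → (∀ {z b} → side z ≡ P → C z ≡ just b → Refuted b z) →
                  ∀ υ → Σ (Fin n) λ z → side z ≡ ownSide v × C z ≡ just (play υ z)
  axiom-witness {C} C∈ refuted υ with All.lookup (wins υ) C∈
  ... | z , eq with side z in sz
  ... | P = ⊥-elim (impossible (refuted-satisfied refl (refuted sz eq′)))
    where
    eq′ : C z ≡ just (a z)
    eq′ = trans eq (cong just (play-P υ sz))
    impossible : ¬ (a z ≡ false × v ≡ false × mono ≡ true)
    impossible (az , v≡ , m≡) =
      All.lookup (positive m≡) (subst (λ v → C ∈ ownCNF F v) v≡ C∈) z sz
                 (trans eq′ (cong just az))
  ... | Q = z , own v C∈ , eq
    where
    own : ∀ v → C ∈ ownCNF F v → side z ≡ ownSide v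
    own false _ = sz
    own true C∈ = contradiction (trans (sym eq) (All.lookup B-vars C∈ z sz)) λ ()
  ... | R = z , own v C∈ , eq
    where
    own : ∀ v → C ∈ ownCNF F v → side z ≡ ownSide v
    own true  _ = sz
    own false C∈ = contradiction (trans (sym eq) (All.lookup A-vars C∈ z sz)) λ ()

  -- An own pivot requires both premises. Otherwise one suffices: its pivot literal is refuted if it
  -- is a p-literal, and literals of the other part are disregarded by validity.
  data Choice (x : Fin n) (g₁ g₂ : Bool) : Set where
    both  : side x ≡ ownSide v → g₁ ≡ v → g₂ ≡ v → Choice x g₁ g₂
    left  : side x ≢ ownSide v → (side x ≡ P → Refuted true x) → g₁ ≡ v → Choice x g₁ g₂
    right : side x ≢ ownSide v → (side x ≡ P → Refuted false x) → g₂ ≡ v → Choice x g₁ g₂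

  either : ∀ {x g₁ g₂ s} → side x ≡ s → s ≢ P → s ≢ ownSide v → g₁ ≡ v ⊎ g₂ ≡ v → Choice x g₁ g₂
  either refl ≢P ≢own (inj₁ eq) = left ≢own (λ sP → contradiction sP ≢P) eq
  either refl ≢P ≢own (inj₂ eq) = right ≢own (λ sP → contradiction sP ≢P) eq

  -- A disjunction is false only if both bits are, which is the own case for a q-pivot; if it is
  -- true, one true bit is enough. The conjunction at an r-pivot is dual.
  choose : ∀ {k} x (i j : Fin k) (val : Fin k → Bool) →
           evalFormula (resolveFormula F {mono = mono} x i j) a val ≡ v → Choice x (val i) (val j)
  choose x i j val = go (side x) refl
    where
    goQ : ∀ w → w ≡ v → side x ≡ Q → val i ∨ val j ≡ v → Choice x (val i) (val j)
    goQ true  refl sQ eq = either sQ (λ ()) (λ ()) (∨-split eq)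
    goQ false refl sQ eq = both sQ (proj₁ (∨-false eq)) (proj₂ (∨-false {val i} eq))
    goR : ∀ w → w ≡ v → side x ≡ R → val i ∧ val j ≡ v → Choice x (val i) (val j)
    goR false refl sR eq = either sR (λ ()) (λ ()) (∧-split eq)
    goR true  refl sR eq = both sR (proj₁ (∧-true eq)) (proj₂ (∧-true {val i} eq))
    go : ∀ s (sx : side x ≡ s) → evalFormula (pivotFormula F {mono = mono} x s sx i j) a val ≡ v →
         Choice x (val i) (val j)
    go P sP eq with selector-split (a x) mono (val i) (val j) v
                      (trans (sym (eval-pivot-P F x sP i j a val)) eq)
    ... | inj₁ (r , eq₁) = left (P≢ownSide v sP) (λ _ → r) eq₁
    ... | inj₂ (r , eq₂) = right (P≢ownSide v sP) (λ _ → r) eq₂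
    go Q sQ eq = goQ v refl sQ eq
    go R sR eq = goR v refl sR eq

-- LQU⁺-Res

-- A universal literal at z says that z differs from a prescribed bit: false for z, true for ¬z,
-- and for z* the value of a function of the universal variables preceding z.
avoided : Pol3 → Bool → Bool
avoided pos  _ = false
avoided negl _ = true
avoided star g = g

avoidedᵐ : Maybe Pol3 → Bool → Bool
avoidedᵐ nothing  g = g
avoidedᵐ (just c) g = avoided c g

avoided-unstarred : ∀ {c} g g′ → c ≢ star → avoided c g ≡ avoided c g′
avoided-unstarred {pos}  _ _ _ = refl
avoided-unstarred {negl} _ _ _ = refl
avoided-unstarred {star} _ _ c≢ = contradiction refl c≢

-- For an unstarred literal this is ordinary truth, so existential literals are covered as well.
HoldsLit : Maybe Pol3 → Bool → Bool → Set
HoldsLit nothing  _ _ = ⊥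
HoldsLit (just c) g b = b ≡ not (avoided c g)

holds-bit : ∀ b g → HoldsLit (just (toPol3 b)) g b
holds-bit true  g = refl
holds-bit false g = refl

-- Any literal can be weakened to a star by guessing the bit that it avoids.
holds-star : ∀ m {g b} → HoldsLit m g b → HoldsLit (just star) (avoidedᵐ m g) b
holds-star (just c) h = h

-- The Boolean `b` is the value of the pivot: if it is true, the second premise has to hold
-- elsewhere. An unmerged variable takes the guess of a premise containing it; if both do, the
-- literals are equal and unstarred, so their truth does not depend on the guess.
resolvedGuess : Bool → Maybe Pol3 → Maybe Pol3 → Bool → Bool → Bool → Bool
resolvedGuess true  m₁       m₂ b g₁ g₂ = if b then avoidedᵐ m₂ g₂ else avoidedᵐ m₁ g₁
resolvedGuess false (just _) _  _ g₁ _  = g₁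
resolvedGuess false nothing  _  _ _  g₂ = g₂

holds-avoided : ∀ m {g b} → HoldsLit m g b → HoldsLit m (avoidedᵐ m g) b
holds-avoided (just pos)  h = h
holds-avoided (just negl) h = h
holds-avoided (just star) h = h

holds-merge₁ : ∀ m₁ m₂ {g b} → HoldsLit m₁ g b → HoldsLit (merge m₁ m₂) g b
holds-merge₁ (just _) _ h = h

holds-merge₂ : ∀ m₁ m₂ {g b} → agree m₁ m₂ → HoldsLit m₂ g b → HoldsLit (merge m₁ m₂) g b
holds-merge₂ nothing  _        _          h = h
holds-merge₂ (just _) (just _) (refl , _) h = h

merge-agree : ∀ m₁ {m₂ c} → agree m₁ m₂ → m₂ ≡ just c → merge m₁ m₂ ≡ just c
merge-agree nothing  _          eq   = eq
merge-agree (just _) (refl , _) refl = refl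

resolved-holds₁ : ∀ m₁ m₂ b′ g₁ g₂ {b} → HoldsLit m₁ g₁ b →
                  HoldsLit (merge m₁ m₂) (resolvedGuess false m₁ m₂ b′ g₁ g₂) b
resolved-holds₁ (just _) _ _ _ _ h = h

resolved-holds₂ : ∀ m₁ m₂ b′ g₁ g₂ {b} → agree m₁ m₂ → HoldsLit m₂ g₂ b →
                  HoldsLit (merge m₁ m₂) (resolvedGuess false m₁ m₂ b′ g₁ g₂) b
resolved-holds₂ nothing  _        _ _  _  _          h = h
resolved-holds₂ (just _) (just _) _ g₁ g₂ (refl , c≢) h = trans h (cong not (avoided-unstarred g₂ g₁ c≢))

module _ {F : Instance} where
  open Instance F

  lqFormula : ∀ {mono ls D} → LQStep F ls D → Formula F mono (length ls)
  lqFormula (axiom C C∈ _)                  = axiomFormula F C∈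
  lqFormula (∀-red C u C∈ _ _ _ _ _)        = wire (index C∈)
  lqFormula (res C₁ C₂ x V C₁∈ C₂∈ _ _ _ _ _) = resolveFormula F x (index C₁∈) (index C₂∈)

  -- Derivations and programs both count from the newest line, so the `index` of a premise is its
  -- wire.
  lqProgram : ∀ {mono ls} → LQDeriv F ls → Program F mono (length ls)
  lqProgram []       = []
  lqProgram (st ∷ d) = lqProgram d ▷ lqFormula st

  lqProgram-cost : ∀ {mono ls} (d : LQDeriv F ls) → totalCost (lqProgram {mono} d) ≤ length ls * 6
  lqProgram-cost []       = z≤n
  lqProgram-cost {mono} (st ∷ d) = +-mono-≤ (cost≤ st) (lqProgram-cost d)
    where
    cost≤ : ∀ {ls D} (st : LQStep F ls D) → cost (lqFormula {mono} st) ≤ 6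
    cost≤ (axiom C C∈ _)                    = cost-axiom F C∈
    cost≤ (∀-red C u C∈ _ _ _ _ _)          = z≤n
    cost≤ (res C₁ C₂ x V C₁∈ C₂∈ _ _ _ _ _) = cost-pivot F x (side x) refl (index C₁∈) (index C₂∈)

-- Validity of LQU⁺-Res lines against a winning strategy

module LQSoundness {F : Instance} {mono : Bool} {a : Assignment (Instance.n F)} {v : Bool}
                   (W : Winning F a v) (positive : mono ≡ true → Instance.p-positive-in-A F) where
  open Instance F
  open Winning W
  open Invariant W positive

  RefutedLit : Pol3 → Fin n → Set
  RefutedLit pos  z = Refuted true z
  RefutedLit negl z = Refuted false z
  RefutedLit star z = ⊤

  refutedLit⇒refuted : ∀ b {z} → RefutedLit (toPol3 b) z → Refuted b z
  refutedLit⇒refuted true  r = r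
  refutedLit⇒refuted false r = r

  PRefuted : LClause n → Set
  PRefuted C = ∀ {z c} → side z ≡ P → C z ≡ just c → RefutedLit c z

  -- Only literals of the own part may be witnesses; p-literals are accounted for separately by
  -- `PRefuted`.
  record Valid (C : LClause n) : Set where
    field
      guess       : Fin n → Assignment n → Bool
      guess-local : ∀ z → Local z (guess z)
      holds       : ∀ υ → Σ (Fin n) λ z → side z ≡ ownSide v × HoldsLit (C z) (guess z υ) (play υ z)

  open Valid

  -- Reducing u: a play υ refuting D is changed at u to the value that refutes the literal at u.
  -- The guesses for later variables are those made after this change.
  ∀-red-own : ∀ {C D : LClause n} {u} → side u ≡ ownSide v → quant u ≡ all →
              (∀ z → quant z ≡ ex → C z ≢ nothing → toℕ z ≤ toℕ u) →
              (∀ z → z ≢ u → D z ≡ C z) → Valid C → Valid D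
  ∀-red-own {C} {D} {u} own u∀ ∃≤u D≡C V = record
    { guess       = λ z υ → guess V z (flip υ)
    ; guess-local = λ z agr → guess-local V z (flip-agree agr)
    ; holds       = holds′ }
    where
    flip : Assignment n → Assignment n
    flip υ = update υ u (avoidedᵐ (C u) (guess V u υ))
    flip-agree : ∀ {z υ υ′} → AgreeBelow z υ υ′ → AgreeBelow z (flip υ) (flip υ′)
    flip-agree agr w w<z with w ≟ u
    ... | yes refl = cong (avoidedᵐ (C u)) (guess-local V u (agreeBelow-≤ (<⇒≤ w<z) agr))
    ... | no _     = agr w w<z
    flip-below : ∀ υ → AgreeBelow u (flip υ) υ
    flip-below υ w w<u = update-other υ u _ λ { refl → <-irrefl refl w<u }
    -- An existential variable of `C` has index at most that of `u`, so its answer cannot see the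
    -- change at `u`.
    play-flip : ∀ υ {z} → z ≢ u → side z ≡ ownSide v → C z ≢ nothing → play (flip υ) z ≡ play υ z
    play-flip υ {z} z≢u sz Cz≢ with quant z in qz
    ... | all = trans (play-∀ _ sz qz) (trans (update-other υ u _ z≢u) (sym (play-∀ υ sz qz)))
    ... | ex  = play-∃ qz (agreeBelow-≤ (∃≤u z qz Cz≢) (flip-below υ))
    refuted-at-u : ∀ υ m → play (flip υ) u ≡ avoidedᵐ m (guess V u υ) →
                   ¬ HoldsLit m (guess V u (flip υ)) (play (flip υ) u)
    refuted-at-u υ (just c) eq h = not-¬ refl
      (trans (sym eq) (trans h (cong (not ∘ avoided c) (guess-local V u (flip-below υ)))))
    holds′ : ∀ υ → Σ (Fin n) λ z → side z ≡ ownSide v × HoldsLit (D z) (guess V z (flip υ)) (play υ z)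
    holds′ υ with holds V (flip υ)
    ... | z , sz , h with z ≟ u
    ... | yes refl = contradiction h (refuted-at-u υ (C u) (trans (play-∀ _ own u∀) (update-same υ u _)))
    ... | no z≢u   = z , sz , subst (λ m → HoldsLit m _ (play υ z)) (sym (D≡C z z≢u))
                                (subst (HoldsLit (C z) _) (play-flip υ z≢u sz (occurs h)) h)
      where
      occurs : ∀ {m g b} → HoldsLit m g b → m ≢ nothing
      occurs {just _} _ ()

  ∀-red-valid : ∀ {C D : LClause n} {u} → quant u ≡ all →
                (∀ z → quant z ≡ ex → C z ≢ nothing → toℕ z ≤ toℕ u) →
                (∀ z → z ≢ u → D z ≡ C z) → Valid C → Valid D
  ∀-red-valid {C} {D} {u} u∀ ∃≤u D≡C V with side u ≟ˢ ownSide v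
  ... | yes own  = ∀-red-own own u∀ ∃≤u D≡C V
  -- The deleted literal is outside the own part, hence never the witness.
  ... | no ¬own = record
    { guess = guess V ; guess-local = guess-local V
    ; holds = λ υ → let z , sz , h = holds V υ in
        z , sz , subst (λ m → HoldsLit m _ (play υ z)) (sym (D≡C z λ { refl → ¬own sz })) h }

  module _ {C₁ C₂ D : LClause n} {x : Fin n} {V : Fin n → Bool}
           (C₁x : C₁ x ≡ just pos) (C₂x : C₂ x ≡ just negl)
           (merged : ∀ z → V z ≡ true → (quant z ≡ all) × (toℕ x < toℕ z) ×
                                        compat (C₁ z) (C₂ z) × (D z ≡ just star))
           (kept : ∀ z → z ≢ x → V z ≡ false → agree (C₁ z) (C₂ z) × (D z ≡ merge (C₁ z) (C₂ z)))
    where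

    D-star : ∀ {z} → V z ≡ true → D z ≡ just star
    D-star {z} Vz = proj₂ (proj₂ (proj₂ (merged z Vz)))

    -- Replacing the guess by the avoided bit leaves a kept literal unaffected and is the right
    -- guess for a star, so one choice serves both cases.
    holds-resolvent₁ : ∀ {z g b} → z ≢ x → HoldsLit (C₁ z) g b → HoldsLit (D z) (avoidedᵐ (C₁ z) g) b
    holds-resolvent₁ {z} {g} {b} z≢x h with V z in Vz
    ... | true  = subst (λ m → HoldsLit m _ b) (sym (D-star Vz)) (holds-star (C₁ z) h)
    ... | false = subst (λ m → HoldsLit m _ b) (sym (proj₂ (kept z z≢x Vz)))
                    (holds-merge₁ (C₁ z) (C₂ z) (holds-avoided (C₁ z) h))

    holds-resolvent₂ : ∀ {z g b} → z ≢ x → HoldsLit (C₂ z) g b → HoldsLit (D z) (avoidedᵐ (C₂ z) g) b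
    holds-resolvent₂ {z} {g} {b} z≢x h with V z in Vz
    ... | true  = subst (λ m → HoldsLit m _ b) (sym (D-star Vz)) (holds-star (C₂ z) h)
    ... | false = subst (λ m → HoldsLit m _ b) (sym (proj₂ (kept z z≢x Vz)))
                    (holds-merge₂ (C₁ z) (C₂ z) (proj₁ (kept z z≢x Vz)) (holds-avoided (C₂ z) h))

    resolve-left : side x ≢ ownSide v → Valid C₁ → Valid D
    resolve-left ¬own V₁ = record
      { guess = λ z υ → avoidedᵐ (C₁ z) (guess V₁ z υ)
      ; guess-local = λ z agr → cong (avoidedᵐ (C₁ z)) (guess-local V₁ z agr)
      ; holds = λ υ → let z , sz , h = holds V₁ υ in
                      z , sz , holds-resolvent₁ (λ { refl → ¬own sz }) h }

    resolve-right : side x ≢ ownSide v → Valid C₂ → Valid D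
    resolve-right ¬own V₂ = record
      { guess = λ z υ → avoidedᵐ (C₂ z) (guess V₂ z υ)
      ; guess-local = λ z agr → cong (avoidedᵐ (C₂ z)) (guess-local V₂ z agr)
      ; holds = λ υ → let z , sz , h = holds V₂ υ in
                      z , sz , holds-resolvent₂ (λ { refl → ¬own sz }) h }

    -- A merged variable lies to the right of the pivot, so its guess may depend on the value of the
    -- pivot, which tells the premise whose remaining literals have to hold.
    resolve-both : side x ≡ ownSide v → Valid C₁ → Valid C₂ → Valid D
    resolve-both own V₁ V₂ = record
      { guess       = joint
      ; guess-local = local
      ; holds       = λ υ → holds′ υ (play υ x) refl }
      where
      joint : Fin n → Assignment n → Bool
      joint z υ = resolvedGuess (V z) (C₁ z) (C₂ z) (play υ x) (guess V₁ z υ) (guess V₂ z υ)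
      -- The strict inequality matters for a universal pivot, whose value is the move at `x` itself.
      play-x : ∀ {z υ υ′} → toℕ x < toℕ z → AgreeBelow z υ υ′ → play υ x ≡ play υ′ x
      play-x x<z agr with quant x in qx
      ... | ex  = play-∃ qx (agreeBelow-≤ (<⇒≤ x<z) agr)
      ... | all = trans (play-∀ _ own qx) (trans (agr x x<z) (sym (play-∀ _ own qx)))
      local : ∀ z → Local z (joint z)
      local z {υ} {υ′} agr with V z in Vz
      ... | true rewrite play-x (proj₁ (proj₂ (merged z Vz))) agr
                       | guess-local V₁ z agr | guess-local V₂ z agr = refl
      ... | false with C₁ z
      ... | just _  = guess-local V₁ z agr
      ... | nothing = guess-local V₂ z agr
      holds-at₁ : ∀ υ {z} → play υ x ≡ false → z ≢ x → HoldsLit (C₁ z) (guess V₁ z υ) (play υ z) →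
                  HoldsLit (D z) (joint z υ) (play υ z)
      holds-at₁ υ {z} px z≢x h with V z in Vz
      ... | true  rewrite px = subst (λ m → HoldsLit m _ (play υ z))
                                 (sym (D-star Vz)) (holds-star (C₁ z) h)
      ... | false = subst (λ m → HoldsLit m _ (play υ z)) (sym (proj₂ (kept z z≢x Vz)))
                      (resolved-holds₁ (C₁ z) (C₂ z) (play υ x) (guess V₁ z υ) (guess V₂ z υ) h)
      holds-at₂ : ∀ υ {z} → play υ x ≡ true → z ≢ x → HoldsLit (C₂ z) (guess V₂ z υ) (play υ z) →
                  HoldsLit (D z) (joint z υ) (play υ z)
      holds-at₂ υ {z} px z≢x h with V z in Vz
      ... | true  rewrite px = subst (λ m → HoldsLit m _ (play υ z))
                                 (sym (D-star Vz)) (holds-star (C₂ z) h)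
      ... | false = subst (λ m → HoldsLit m _ (play υ z)) (sym (proj₂ (kept z z≢x Vz)))
                      (resolved-holds₂ (C₁ z) (C₂ z) (play υ x) (guess V₁ z υ) (guess V₂ z υ) (proj₁ (kept z z≢x Vz)) h)
      holds′ : ∀ υ b → play υ x ≡ b →
               Σ (Fin n) λ z → side z ≡ ownSide v × HoldsLit (D z) (joint z υ) (play υ z)
      holds′ υ false px with holds V₁ υ
      ... | z , sz , h with z ≟ x
      ... | yes refl = contradiction
            (trans (sym px) (subst (λ m → HoldsLit m (guess V₁ z υ) (play υ z)) C₁x h)) λ ()
      ... | no z≢x   = z , sz , holds-at₁ υ px z≢x h
      holds′ υ true px with holds V₂ υ
      ... | z , sz , h with z ≟ x
      ... | yes refl = contradiction
            (trans (sym px) (subst (λ m → HoldsLit m (guess V₂ z υ) (play υ z)) C₂x h)) λ ()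
      ... | no z≢x   = z , sz , holds-at₂ υ px z≢x h

  lq-step : ∀ {ls D} (st : LQStep F ls D) (val : Fin (length ls) → Bool) →
            (∀ {C} (C∈ : C ∈ ls) → val (index C∈) ≡ v → PRefuted C → Valid C) →
            evalFormula (lqFormula {mono = mono} st) a val ≡ v → PRefuted D → Valid D
  lq-step {D = D} (axiom C C∈ D≡C) val ih eq ref = record
    { guess = λ _ _ → false ; guess-local = λ _ _ → refl
    ; holds = λ υ → let z , sz , Cz = axiom-witness (axiom-own C∈ {val} eq) refC υ in
                    z , sz , subst (λ m → HoldsLit m false (play υ z))
                                   (sym (trans (D≡C z) (cong (Maybe.map toPol3) Cz)))
                                   (holds-bit (play υ z) false) }
    where
    refC : ∀ {z b} → side z ≡ P → C z ≡ just b → Refuted b z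
    refC {z} {b} sP Cz = refutedLit⇒refuted b (ref sP (trans (D≡C z) (cong (Maybe.map toPol3) Cz)))
  lq-step (∀-red C u C∈ u∀ _ ∃≤u _ D≡C) val ih eq ref =
    ∀-red-valid u∀ ∃≤u D≡C (ih C∈ eq λ {z} sP Cz → ref sP (trans (D≡C z (z≢u sP)) Cz))
    where
    z≢u : ∀ {z} → side z ≡ P → z ≢ u
    z≢u sP refl = ex≢all (p-ex u sP) u∀
  lq-step {D = D} (res C₁ C₂ x V C₁∈ C₂∈ C₁x C₂x Dx merged kept) val ih eq ref =
    resolve (choose x (index C₁∈) (index C₂∈) val eq)
    where
    -- Merged variables are universal and p-variables existential, so p-literals reach the resolvent
    -- unchanged.
    unmerged : ∀ {z} → side z ≡ P → V z ≡ false
    unmerged {z} sP = ¬-not λ Vz → ex≢all (p-ex z sP) (proj₁ (merged z Vz))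
    refuted₁ : (side x ≡ P → Refuted true x) → PRefuted C₁
    refuted₁ r {z} {c} sP C₁z with z ≟ x
    ... | yes refl = subst (λ c → RefutedLit c x) (just-injective (trans (sym C₁x) C₁z)) (r sP)
    ... | no z≢x   = ref sP (trans (proj₂ (kept z z≢x (unmerged sP)))
                                   (cong (λ m → merge m (C₂ z)) C₁z))
    refuted₂ : (side x ≡ P → Refuted false x) → PRefuted C₂
    refuted₂ r {z} {c} sP C₂z with z ≟ x
    ... | yes refl = subst (λ c → RefutedLit c x) (just-injective (trans (sym C₂x) C₂z)) (r sP)
    ... | no z≢x   = ref sP (trans (proj₂ (kept z z≢x (unmerged sP)))
                                   (merge-agree (C₁ z) (proj₁ (kept z z≢x (unmerged sP))) C₂z))
    resolve : Choice x (val (index C₁∈)) (val (index C₂∈)) → Valid D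
    resolve (both own eq₁ eq₂) = resolve-both C₁x C₂x merged kept own
      (ih C₁∈ eq₁ (refuted₁ λ sP → contradiction own (P≢ownSide v sP)))
      (ih C₂∈ eq₂ (refuted₂ λ sP → contradiction own (P≢ownSide v sP)))
    resolve (left ¬own r eq₁)  = resolve-left C₁x C₂x merged kept ¬own (ih C₁∈ eq₁ (refuted₁ r))
    resolve (right ¬own r eq₂) = resolve-right C₁x C₂x merged kept ¬own (ih C₂∈ eq₂ (refuted₂ r))

  lq-valid : ∀ {ls} (d : LQDeriv F ls) {C} (C∈ : C ∈ ls) →
             evalProgram (lqProgram {mono = mono} d) a (index C∈) ≡ v → PRefuted C → Valid C
  lq-valid (st ∷ d) (here refl) = lq-step st (evalProgram (lqProgram d) a) (lq-valid d)
  lq-valid (st ∷ d) (there C∈)  = lq-valid d C∈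

  lq-sound : ∀ {D ls} (d : LQDeriv F (D ∷ ls)) → (∀ z → D z ≡ nothing) →
             evalProgram (lqProgram {mono = mono} d) a zero ≢ v
  lq-sound {D} d D≡∅ eq = absurd (holds V (λ _ → false))
    where
    V : Valid D
    V = lq-valid d (here refl) eq λ {z} _ Dz → contradiction (trans (sym (D≡∅ z)) Dz) λ ()
    absurd : ¬ Σ (Fin n) λ z → side z ≡ ownSide v ×
                 HoldsLit (D z) (guess V z (λ _ → false)) (play (λ _ → false) z)
    absurd (z , _ , h) with D z | D≡∅ z
    ... | nothing | refl = h

-- IRM-calc

_≟ᵃ_ : DecidableEquality AV
a0 ≟ᵃ a0 = yes refl
a0 ≟ᵃ a1 = no λ ()
a0 ≟ᵃ a* = no λ ()
a1 ≟ᵃ a0 = no λ ()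
a1 ≟ᵃ a1 = yes refl
a1 ≟ᵃ a* = no λ ()
a* ≟ᵃ a0 = no λ ()
a* ≟ᵃ a1 = no λ ()
a* ≟ᵃ a* = yes refl

_≟ˡ_ : ∀ {n} → DecidableEquality (ALit n)
mkLit x p σ ≟ˡ mkLit y q τ = map′ (λ { (refl , refl , refl) → refl }) (λ { refl → refl , refl , refl })
  ((x ≟ y) ×-dec (p ≟ᵇ q) ×-dec vec-≡-dec (maybe-≡-dec _≟ᵃ_) σ τ)

lookup-compose : ∀ {n} (σ τ : Ann n) u → lookup (compose σ τ) u ≡ (lookup σ u <∣> lookup τ u)
lookup-compose (just _  ∷ σ) (_ ∷ τ) zero    = refl
lookup-compose (nothing ∷ σ) (_ ∷ τ) zero    = refl
lookup-compose (_       ∷ σ) (_ ∷ τ) (suc u) = lookup-compose σ τ u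

lookup-restrict : ∀ {n} (x : Fin n) σ {u} → toℕ u < toℕ x → lookup (restrict x σ) u ≡ lookup σ u
lookup-restrict x σ {u} u<x = trans (lookup∘tabulate _ u)
  (cong (λ b → if b then lookup σ u else nothing) (Equivalence.to T-≡ (<⇒<ᵇ u<x)))

-- An annotation value as a constraint on an optional move of the universal player.
Match : Maybe AV → Maybe Bool → Set
Match nothing   nothing      = ⊤
Match (just a0) (just false) = ⊤
Match (just a1) (just true)  = ⊤
Match (just a*) (just _)     = ⊤
Match _         _            = ⊥

match? : ∀ α m → Dec (Match α m)
match? nothing   nothing      = yes tt
match? nothing   (just _)     = no λ ()
match? (just a0) nothing      = no λ ()
match? (just a0) (just false) = yes tt
match? (just a0) (just true)  = no λ ()
match? (just a1) nothing      = no λ ()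
match? (just a1) (just false) = no λ ()
match? (just a1) (just true)  = yes tt
match? (just a*) nothing      = no λ ()
match? (just a*) (just _)     = yes tt

match-star : ∀ α {m} → Match (just α) m → Match (just a*) m
match-star a0 {just _} _ = tt
match-star a1 {just _} _ = tt
match-star a* {just _} _ = tt

match-merge₁ : ∀ {n} (μ σ : Ann n) u {m} → sameDom (lookup μ u) (lookup σ u) →
               Match (lookup μ u) m → Match (lookup (mergeAnn μ σ) u) m
match-merge₁ (nothing ∷ μ) (nothing ∷ σ) zero _ h = h
match-merge₁ (just α ∷ μ) (just β ∷ σ) zero _ h with α ==AV β
... | true  = h
... | false = match-star α h
match-merge₁ (_ ∷ μ) (_ ∷ σ) (suc u) = match-merge₁ μ σ u

==AV-sound : ∀ α β → (α ==AV β) ≡ true → α ≡ β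
==AV-sound a0 a0 _ = refl
==AV-sound a1 a1 _ = refl
==AV-sound a* a* _ = refl

match-merge₂ : ∀ {n} (μ σ : Ann n) u {m} → sameDom (lookup μ u) (lookup σ u) →
               Match (lookup σ u) m → Match (lookup (mergeAnn μ σ) u) m
match-merge₂ (nothing ∷ μ) (nothing ∷ σ) zero _ h = h
match-merge₂ (just α ∷ μ) (just β ∷ σ) zero {m} _ h with α ==AV β in eq
... | true  = subst (λ α → Match (just α) m) (sym (==AV-sound α β eq)) h
... | false = match-star β h
match-merge₂ (_ ∷ μ) (_ ∷ σ) (suc u) = match-merge₂ μ σ u

-- The effect of instantiation on a strategy: prescribed moves stay and a missing move has to match
-- `μ`. This mirrors the precedence in `compose`.
Extends : Maybe AV → Maybe Bool → Maybe Bool → Set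
Extends μ (just b) m′ = m′ ≡ just b
Extends μ nothing  m′ = Match μ m′

-- For `a*` either bit would match; `false` is a default.
fill : AV → Bool
fill a1 = true
fill _  = false

complete : Maybe AV → Maybe Bool → Maybe Bool
complete μ m = m <∣> Maybe.map fill μ

complete-extends : ∀ μ m → Extends μ m (complete μ m)
complete-extends _         (just _) = refl
complete-extends nothing   nothing  = tt
complete-extends (just a0) nothing  = tt
complete-extends (just a1) nothing  = tt
complete-extends (just a*) nothing  = tt

match-extends : ∀ α μ m {m′} → Match α m → Extends μ m m′ → Match (α <∣> μ) m′
match-extends nothing   μ nothing      _ e    = e
match-extends (just a0) μ (just false) _ refl = tt
match-extends (just a1) μ (just true)  _ refl = tt
match-extends (just a*) μ (just _)     _ refl = tt

match-nothing : ∀ α → ¬ Match (just α) nothing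
match-nothing a0 ()
match-nothing a1 ()
match-nothing a* ()

-- If `m₁` is absent, matching forces `τ` and `ξ` to be undefined, and what `m₂` matches is then
-- exactly `σ`.
extends-first : ∀ τ ξ σ m₁ m₂ → Match (τ <∣> ξ) m₁ → Match (τ <∣> σ) m₂ → Extends σ m₁ (m₁ <∣> m₂)
extends-first τ        ξ        σ (just _) m₂ _  _  = refl
extends-first nothing  nothing  σ nothing  m₂ _  h₂ = h₂
extends-first nothing  (just α) σ nothing  m₂ h₁ _  = contradiction h₁ (match-nothing α)
extends-first (just α) _        σ nothing  m₂ h₁ _  = contradiction h₁ (match-nothing α)

-- The joint move prefers `m₁`, so it must not contradict `m₂`. Where `τ` is defined both moves are
-- the same bit, which `*` would not guarantee; elsewhere disjointness of `ξ` and `σ` leaves at most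
-- one of the moves present.
extends-second : ∀ τ ξ σ m₁ m₂ → ξ ≡ nothing ⊎ σ ≡ nothing → τ ≢ just a* →
                 Match (τ <∣> ξ) m₁ → Match (τ <∣> σ) m₂ → Extends ξ m₂ (m₁ <∣> m₂)
extends-second (just a0) _ _ (just false) (just false) _ _  _ _ = refl
extends-second (just a1) _ _ (just true)  (just true)  _ _  _ _ = refl
extends-second (just a*) _ _ _            _            _ τ≢ _ _ = contradiction refl τ≢
extends-second nothing (just _) (just _) _ _ (inj₁ ())
extends-second nothing (just _) (just _) _ _ (inj₂ ())
extends-second nothing nothing  _        nothing  (just _) _ _ _ _  = refl
extends-second nothing nothing  (just α) nothing  nothing  _ _ _ h₂ = contradiction h₂ (match-nothing α)
extends-second nothing _        nothing  (just _) nothing  _ _ h₁ _ = h₁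
extends-second nothing _        nothing  nothing  nothing  _ _ h₁ _ = h₁

module _ {F : Instance} where
  open Instance F

  irmFormula : ∀ {mono ls E} → IRMStep F ls E → Formula F mono (length ls)
  irmFormula (axiom C C∈ _)              = axiomFormula F C∈
  irmFormula (inst D τ D∈ _ _ _)         = wire (index D∈)
  irmFormula (res D₁ D₂ x τ ξ σ D₁∈ D₂∈ _ _ _ _ _ _ _) = resolveFormula F x (index D₁∈) (index D₂∈)
  irmFormula (merging D b p μ σ D∈ _ _ _ _) = wire (index D∈)

  irmProgram : ∀ {mono ls} → IRMDeriv F ls → Program F mono (length ls)
  irmProgram []       = []
  irmProgram (st ∷ d) = irmProgram d ▷ irmFormula st

  irmProgram-cost : ∀ {mono ls} (d : IRMDeriv F ls) → totalCost (irmProgram {mono} d) ≤ length ls * 6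
  irmProgram-cost []       = z≤n
  irmProgram-cost {mono} (st ∷ d) = +-mono-≤ (cost≤ st) (irmProgram-cost d)
    where
    cost≤ : ∀ {ls E} (st : IRMStep F ls E) → cost (irmFormula {mono} st) ≤ 6
    cost≤ (axiom C C∈ _)                 = cost-axiom F C∈
    cost≤ (inst D τ D∈ _ _ _)            = z≤n
    cost≤ (res D₁ D₂ x τ ξ σ D₁∈ D₂∈ _ _ _ _ _ _ _) = cost-pivot F x (side x) refl (index D₁∈) (index D₂∈)
    cost≤ (merging D b p μ σ D∈ _ _ _ _) = z≤n

lookup-axAnn : ∀ F C {z b} → Instance.quant F z ≡ all → C z ≡ just b →
               lookup (axAnn F C) z ≡ just (bitOf (not b))
lookup-axAnn F C {z} q Cz with lookup (axAnn F C) z | entry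
  where
  entry : lookup (axAnn F C) z ≡ _
  entry = lookup∘tabulate _ z
... | _ | eq rewrite q | Cz = eq

fill-bitOf : ∀ b → fill (bitOf b) ≡ b
fill-bitOf true  = refl
fill-bitOf false = refl

-- A strategy of the universal player that need not fix all moves.
Moves : ℕ → Set
Moves n = Fin n → Assignment n → Maybe Bool

Follows : ∀ {n} → Moves n → Assignment n → Set
Follows move υ = ∀ u {b} → move u υ ≡ just b → υ u ≡ b

module _ {n} (move : Moves n) (local : ∀ u → Local u (move u)) where

  followUpTo : ℕ → Assignment n
  followUpTo zero    u = false
  followUpTo (suc k) u = Maybe.fromMaybe false (move u (followUpTo k))

  -- By locality the move at `u` sees only earlier variables, so round `k` settles all indices below
  -- `k`, and `n` rounds reach a fixed point.
  followUpTo-stable : ∀ k {u} → toℕ u < k → followUpTo (suc k) u ≡ followUpTo k u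
  followUpTo-stable (suc k) {u} (s≤s u≤k) = cong (Maybe.fromMaybe false)
    (local u λ w w<u → followUpTo-stable k (<-≤-trans w<u u≤k))

  -- Validity speaks only of plays that follow the strategy; the empty clause is contradictory
  -- because such a play exists.
  following : Σ (Assignment n) (Follows move)
  following = followUpTo n , λ u eq →
    trans (sym (followUpTo-stable n (toℕ<n u))) (cong (Maybe.fromMaybe false) eq)

extends-follows : ∀ {n} (move move′ : Moves n) μ {υ} →
                  (∀ u → Extends (lookup μ u) (move u υ) (move′ u υ)) → Follows move′ υ → Follows move υ
extends-follows move move′ μ {υ} ext fol u eq with move u υ | ext u
extends-follows move move′ μ ext fol u refl | just b | e = fol u e

data Phase : Set where
  undecided first second : Phase

settle : Phase → Phase → Phase
settle undecided p = p
settle p         _ = p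

-- The universal strategies of two premises are followed simultaneously as long as both match the
-- annotations of the pivots.  The first deviation, or else the value of the pivot, decides which
-- premise has a true literal other than the pivot; from then on only its strategy is followed.
module Joint {n} (reply : Assignment n → Fin n → Bool) (reply-local : ∀ z → Local z (λ υ → reply υ z))
             (move₁ move₂ : Moves n)
             (local₁ : ∀ u → Local u (move₁ u)) (local₂ : ∀ u → Local u (move₂ u))
             (x : Fin n) (τ ξ σ : Ann n) where

  Match₁ Match₂ : Fin n → Assignment n → Set
  Match₁ u υ = Match (lookup τ u <∣> lookup ξ u) (move₁ u υ)
  Match₂ u υ = Match (lookup τ u <∣> lookup σ u) (move₂ u υ)

  compareMoves : ∀ {A B : Set} → Dec A → Dec B → Phase
  compareMoves (no _)  _       = first
  compareMoves (yes _) (no _)  = second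
  compareMoves (yes _) (yes _) = undecided

  -- A strategy that violates the annotation of its pivot literal rules this literal out as the
  -- witness, so its premise can be chosen.
  deviation : Fin n → Assignment n → Phase
  deviation u υ = compareMoves (match? (lookup τ u <∣> lookup ξ u) (move₁ u υ))
                               (match? (lookup τ u <∣> lookup σ u) (move₂ u υ))

  check : Fin n → Assignment n → Phase
  check u υ with <-cmp (toℕ u) (toℕ x)
  ... | tri< _ _ _ = deviation u υ
  -- A true pivot falsifies the pivot literal of the second premise, a false one that of the first.
  ... | tri≈ _ _ _ = if reply υ x then second else first
  ... | tri> _ _ _ = undecided

  stage : ℕ → Assignment n → Phase
  stage k υ with k <? n
  ... | yes k<n = check (fromℕ< k<n) υ
  ... | no _    = undecided

  phase : ℕ → Assignment n → Phase
  phase zero    υ = undecided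
  phase (suc k) υ = settle (phase k υ) (stage k υ)

  check-local : ∀ u → Local u (check u)
  check-local u agr with <-cmp (toℕ u) (toℕ x)
  ... | tri< _ _ _   = cong₂ (λ m₁ m₂ → compareMoves (match? _ m₁) (match? _ m₂)) (local₁ u agr) (local₂ u agr)
  ... | tri≈ _ u≡x _ = cong (if_then second else first) (reply-local x (agreeBelow-≤ (≤-reflexive (sym u≡x)) agr))
  ... | tri> _ _ _   = refl

  -- The check at `w` sees only moves before `w`. Hence the phase reached after the check at `u`
  -- still depends only on moves before `u`.
  phase-local : ∀ k {υ υ′} → (∀ w → toℕ w < k → AgreeBelow w υ υ′) → phase k υ ≡ phase k υ′
  phase-local zero    agr = refl
  phase-local (suc k) {υ} {υ′} agr =
    cong₂ settle (phase-local k λ w w<k → agr w (<-trans w<k (n<1+n k))) stage≡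
    where
    stage≡ : stage k υ ≡ stage k υ′
    stage≡ with k <? n
    ... | yes k<n = check-local (fromℕ< k<n) (agr _ (s≤s (≤-reflexive (toℕ-fromℕ< k<n))))
    ... | no _    = refl

  stage-toℕ : ∀ u υ → stage (toℕ u) υ ≡ check u υ
  stage-toℕ u υ with toℕ u <? n
  ... | yes u<n = cong (λ w → check w υ) (fromℕ<-toℕ u u<n)
  ... | no u≮n  = contradiction (toℕ<n u) u≮n

  persist : ∀ {k m υ p} → k ≤ m → phase k υ ≡ p → p ≢ undecided → phase m υ ≡ p
  persist {m = m} k≤m eq p≢ with m≤n⇒m<n∨m≡n k≤m
  persist k≤m eq p≢ | inj₂ refl = eq
  persist {m = suc m} {υ} {p} _ eq p≢ | inj₁ (s≤s k≤m)
    rewrite persist {m = m} {υ} k≤m eq p≢ with p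
  ... | undecided = contradiction refl p≢
  ... | first     = refl
  ... | second    = refl

  persist-undecided : ∀ {k m υ} → k ≤ m → phase m υ ≡ undecided → phase k υ ≡ undecided
  persist-undecided {k} {υ = υ} k≤m eq with phase k υ in eqₖ
  ... | undecided = refl
  ... | first     = contradiction (trans (sym eq) (persist k≤m eqₖ λ ())) λ ()
  ... | second    = contradiction (trans (sym eq) (persist k≤m eqₖ λ ())) λ ()

  settle-undecided : ∀ p {c} → settle p c ≡ undecided → c ≡ undecided
  settle-undecided undecided eq = eq

  undecided-check : ∀ u υ → phase (suc (toℕ u)) υ ≡ undecided → check u υ ≡ undecided
  undecided-check u υ eq = trans (sym (stage-toℕ u υ)) (settle-undecided (phase (toℕ u) υ) eq)

  decided-at-pivot : ∀ υ → check x υ ≢ undecided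
  decided-at-pivot υ eq with <-cmp (toℕ x) (toℕ x)
  ... | tri< x<x _ _ = <-irrefl refl x<x
  ... | tri> _ _ x<x = <-irrefl refl x<x
  ... | tri≈ _ _ _ with reply υ x | eq
  ...   | true  | ()
  ...   | false | ()

  decided : ∀ υ → phase n υ ≢ undecided
  decided υ eq = decided-at-pivot υ (undecided-check x υ (persist-undecided (toℕ<n x) eq))

  -- The pivot always forces a decision, so `u` precedes `x`, where remaining undecided means that
  -- both comparisons succeeded.
  undecided-matches : ∀ u υ → phase (suc (toℕ u)) υ ≡ undecided → Match₁ u υ × Match₂ u υ
  undecided-matches u υ eq with <-cmp (toℕ u) (toℕ x) | undecided-check u υ eq
  ... | tri≈ _ u≡x _ | _ rewrite toℕ-injective u≡x =
        contradiction (undecided-check x υ eq) (decided-at-pivot υ)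
  ... | tri> _ _ x<u | _ = contradiction
        (undecided-check x υ (persist-undecided (s≤s (<⇒≤ x<u)) eq)) (decided-at-pivot υ)
  ... | tri< _ _ _   | c
    with match? (lookup τ u <∣> lookup ξ u) (move₁ u υ) | match? (lookup τ u <∣> lookup σ u) (move₂ u υ)
  ...   | yes h₁ | yes h₂ = h₁ , h₂

  never : ∀ {p υ} → p ≢ undecided → (∀ u → check u υ ≢ p) → ∀ k → phase k υ ≢ p
  never p≢ c≢ zero    eq = p≢ (sym eq)
  never {υ = υ} p≢ c≢ (suc k) eq with phase k υ in eqₖ
  ... | first  = never p≢ c≢ k (trans eqₖ eq)
  ... | second = never p≢ c≢ k (trans eqₖ eq)
  ... | undecided with k <? n
  ...   | yes k<n = c≢ (fromℕ< k<n) eq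
  ...   | no _    = p≢ (sym eq)

  -- The hypotheses are those of the pivot literal being the witness in the first premise. Thus,
  -- once the phase is `first`, the witness is another literal.
  never-first : ∀ {υ} → (∀ u → toℕ u < toℕ x → Match₁ u υ) → reply υ x ≡ true → phase n υ ≢ first
  never-first {υ} h rx = never (λ ()) check≢ n
    where
    check≢ : ∀ u → check u υ ≢ first
    check≢ u eq with <-cmp (toℕ u) (toℕ x)
    ... | tri≈ _ _ _ rewrite rx = contradiction eq λ ()
    ... | tri> _ _ _ = contradiction eq λ ()
    ... | tri< u<x _ _
      with match? (lookup τ u <∣> lookup ξ u) (move₁ u υ) | match? (lookup τ u <∣> lookup σ u) (move₂ u υ)
    ...   | no ¬h | _     = ¬h (h u u<x)
    ...   | yes _ | yes _ = contradiction eq λ ()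
    ...   | yes _ | no _  = contradiction eq λ ()

  never-second : ∀ {υ} → (∀ u → toℕ u < toℕ x → Match₂ u υ) → reply υ x ≡ false → phase n υ ≢ second
  never-second {υ} h rx = never (λ ()) check≢ n
    where
    check≢ : ∀ u → check u υ ≢ second
    check≢ u eq with <-cmp (toℕ u) (toℕ x)
    ... | tri≈ _ _ _ rewrite rx = contradiction eq λ ()
    ... | tri> _ _ _ = contradiction eq λ ()
    ... | tri< u<x _ _
      with match? (lookup τ u <∣> lookup ξ u) (move₁ u υ) | match? (lookup τ u <∣> lookup σ u) (move₂ u υ)
    ...   | no _  | _     = contradiction eq λ ()
    ...   | yes _ | yes _ = contradiction eq λ ()
    ...   | yes _ | no ¬h = ¬h (h u u<x)

  jointMove : Phase → Maybe AV → Maybe AV → Maybe Bool → Maybe Bool → Maybe Bool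
  jointMove undecided _  _  m₁ m₂ = m₁ <∣> m₂
  jointMove first     _  s  m₁ _  = complete s m₁
  jointMove second    t  _  _  m₂ = complete t m₂

  move : Moves n
  -- The phase is taken after the check at `u`, so that a deviation at `u` itself already takes
  -- effect.
  move u υ = jointMove (phase (suc (toℕ u)) υ) (lookup ξ u) (lookup σ u) (move₁ u υ) (move₂ u υ)

  move-local : ∀ u → Local u (move u)
  move-local u agr
    rewrite phase-local (suc (toℕ u)) (λ w w≤u → agreeBelow-≤ (≤-pred w≤u) agr)
          | local₁ u agr | local₂ u agr = refl

  -- Decisions are final, so each earlier phase is `undecided` or `first`; in both the joint move
  -- extends the first strategy by `σ`, the instantiation applied to the first premise.
  extends₁ : ∀ {υ} → phase n υ ≡ first → ∀ u → Extends (lookup σ u) (move₁ u υ) (move u υ)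
  extends₁ {υ} eq u with phase (suc (toℕ u)) υ in eqᵤ
  ... | first     = complete-extends (lookup σ u) (move₁ u υ)
  ... | second    = contradiction (trans (sym eq) (persist (toℕ<n u) eqᵤ λ ())) λ ()
  ... | undecided = let h₁ , h₂ = undecided-matches u υ eqᵤ in
                    extends-first (lookup τ u) (lookup ξ u) (lookup σ u) (move₁ u υ) (move₂ u υ) h₁ h₂

  extends₂ : (∀ u → lookup ξ u ≡ nothing ⊎ lookup σ u ≡ nothing) → (∀ u → lookup τ u ≢ just a*) →
             ∀ {υ} → phase n υ ≡ second → ∀ u → Extends (lookup ξ u) (move₂ u υ) (move u υ)
  extends₂ dis τ≢ {υ} eq u with phase (suc (toℕ u)) υ in eqᵤ
  ... | second    = complete-extends (lookup ξ u) (move₂ u υ)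
  ... | first     = contradiction (trans (sym eq) (persist (toℕ<n u) eqᵤ λ ())) λ ()
  ... | undecided = let h₁ , h₂ = undecided-matches u υ eqᵤ in
                    extends-second (lookup τ u) (lookup ξ u) (lookup σ u) (move₁ u υ) (move₂ u υ)
                                   (dis u) (τ≢ u) h₁ h₂

-- Validity of IRM-calc lines against a winning strategy

module IRMSoundness {F : Instance} {mono : Bool} {a : Assignment (Instance.n F)} {v : Bool}
                    (W : Winning F a v) (positive : mono ≡ true → Instance.p-positive-in-A F) where
  open Instance F
  open Winning W
  open Invariant W positive
  open ALit

  -- The type of annotated literals admits universal variables. The constant reply there makes
  -- locality hold at every variable, the pivot included.
  reply : Assignment n → Fin n → Bool
  reply υ z with quant z
  ... | ex  = play υ z
  ... | all = false

  reply-ex : ∀ {z} → quant z ≡ ex → ∀ υ → reply υ z ≡ play υ z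
  reply-ex {z} q υ with quant z | q
  ... | ex | refl = refl

  reply-local : ∀ z → Local z (λ υ → reply υ z)
  reply-local z agr with quant z in q
  ... | ex  = play-∃ q agr
  ... | all = refl

  PRefuted : AClause n → Set
  PRefuted C = ∀ {l} → l ∈ C → side (var l) ≡ P → Refuted (pol l) (var l)

  record Witness (C : AClause n) (move : Moves n) (υ : Assignment n) : Set where
    constructor witness
    field
      lit     : ALit n
      lit∈    : lit ∈ C
      own     : side (var lit) ≡ ownSide v
      holds   : reply υ (var lit) ≡ pol lit
      matches : ∀ {u} → toℕ u < toℕ (var lit) → Match (lookup (ann lit) u) (move u υ)

  record Valid (C : AClause n) : Set where
    field
      move       : Moves n
      move-local : ∀ u → Local u (move u)
      answer     : ∀ υ → Follows move υ → Witness C move υ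

  open Witness
  open Valid

  inst-witness : ∀ {D E move υ} (move′ : Moves n) μ (w : Witness D move υ) →
                 (∀ u → Extends (lookup μ u) (move u υ) (move′ u υ)) →
                 instLit μ (lit w) ∈ E → Witness E move′ υ
  inst-witness {move = move} {υ} move′ μ w ext l∈E = witness _ l∈E (own w) (holds w) λ {u} u<x →
    subst (λ α → Match α (move′ u υ))
          (sym (trans (lookup-restrict (var (lit w)) (compose (ann (lit w)) μ) u<x) (lookup-compose (ann (lit w)) μ u)))
          (match-extends (lookup (ann (lit w)) u) (lookup μ u) (move u υ) (matches w u<x) (ext u))

  -- This serves the instantiation rule and also resolution on a pivot outside the own part, where
  -- the own literals of one premise all survive, instantiated.
  inst-valid : ∀ {D E : AClause n} μ → (∀ {l} → l ∈ D → side (var l) ≡ ownSide v → instLit μ l ∈ E) →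
               Valid D → Valid E
  inst-valid μ ⊆E V = record
    { move       = move′
    ; move-local = λ u agr → cong (complete (lookup μ u)) (move-local V u agr)
    ; answer     = λ υ fol → let w = answer V υ (extends-follows (move V) move′ μ (ext υ) fol) in
                   inst-witness move′ μ w (ext υ) (⊆E (lit∈ w) (own w)) }
    where
    move′ : Moves n
    move′ u υ = complete (lookup μ u) (move V u υ)
    ext : ∀ υ u → Extends (lookup μ u) (move V u υ) (move′ u υ)
    ext υ u = complete-extends (lookup μ u) (move V u υ)

  -- The universal player falsifies all universal literals of the clause. The literal satisfied by
  -- the winning play is then existential, and its annotation records just these moves.
  axiom-valid : ∀ {C E} → C ∈ ownCNF F v → (∀ {z b} → side z ≡ P → C z ≡ just b → Refuted b z) →
                (∀ {z b} → quant z ≡ ex → C z ≡ just b → mkLit z b (restrict z (axAnn F C)) ∈ E) →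
                Valid E
  axiom-valid {C} {E} C∈ refC lit∈E = record
    { move = falsify ; move-local = λ _ _ → refl ; answer = answer′ }
    where
    falsify : Moves n
    falsify u _ = complete (lookup (axAnn F C) u) nothing
    answer′ : ∀ υ → Follows falsify υ → Witness E falsify υ
    answer′ υ fol with axiom-witness C∈ refC υ
    ... | z , sz , Cz with quant z in q
    ... | ex  = witness _ (lit∈E q Cz) sz (reply-ex q υ) λ {u} u<z →
      subst (λ α → Match α (falsify u υ)) (sym (lookup-restrict z (axAnn F C) u<z))
            (complete-extends (lookup (axAnn F C) u) nothing)
    ... | all = contradiction (trans (play-∀ υ sz q) (fol z forced)) (not-¬ refl)
      where
      forced : falsify z υ ≡ just (not (play υ z))
      forced rewrite lookup-axAnn F C q Cz = cong just (fill-bitOf (not (play υ z)))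

  -- The strategy is unchanged: merging keeps common values and puts `*` elsewhere, which accepts
  -- every prescribed move.
  merging-valid : ∀ {D E : AClause n} b p μ σ → (∀ z → sameDom (lookup μ z) (lookup σ z)) →
                  (∀ {l} → l ∈ D → l ≢ mkLit b p μ → l ≢ mkLit b p σ → l ∈ E) →
                  mkLit b p (mergeAnn μ σ) ∈ E → Valid D → Valid E
  merging-valid {D} {E} b p μ σ dom kept merged V = record
    { move = move V ; move-local = move-local V ; answer = λ υ fol → convert (answer V υ fol) }
    where
    convert : ∀ {υ} → Witness D (move V) υ → Witness E (move V) υ
    convert (witness l l∈ own h m) with l ≟ˡ mkLit b p μ
    ... | yes refl = witness _ merged own h λ {u} u<b → match-merge₁ μ σ u (dom u) (m u<b)
    ... | no l≢μ with l ≟ˡ mkLit b p σ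
    ... | yes refl = witness _ merged own h λ {u} u<b → match-merge₂ μ σ u (dom u) (m u<b)
    ... | no l≢σ   = witness l (kept l∈ l≢μ l≢σ) own h m

  -- The final phase names a premise whose strategy is followed by every play that follows the joint
  -- one. That premise has a witness other than the pivot, and its instance lies in `E`.
  resolve-valid : ∀ {D₁ D₂ E : AClause n} x τ ξ σ → Disjoint F ξ σ → (∀ z → lookup τ z ≢ just a*) →
                  (∀ {l} → l ∈ D₁ → l ≢ mkLit x true (compose τ ξ) → instLit σ l ∈ E) →
                  (∀ {l} → l ∈ D₂ → l ≢ mkLit x false (compose τ σ) → instLit ξ l ∈ E) →
                  Valid D₁ → Valid D₂ → Valid E
  resolve-valid {D₁} {D₂} {E} x τ ξ σ dis τ≢ ⊆E₁ ⊆E₂ V₁ V₂ = record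
    { move = J.move ; move-local = J.move-local ; answer = answer′ }
    where
    module J = Joint reply reply-local (move V₁) (move V₂) (move-local V₁) (move-local V₂) x τ ξ σ
    answer₁ : ∀ υ → J.phase n υ ≡ first → Follows J.move υ → Witness E J.move υ
    answer₁ υ eq fol = inst-witness J.move σ w (J.extends₁ eq) (⊆E₁ (lit∈ w) ≢pivot)
      where
      w = answer V₁ υ (extends-follows (move V₁) J.move σ (J.extends₁ eq) fol)
      ≢pivot : lit w ≢ mkLit x true (compose τ ξ)
      ≢pivot l≡ with w
      ≢pivot refl | witness _ _ _ h m = J.never-first
        (λ u u<x → subst (λ α → Match α (move V₁ u υ)) (lookup-compose τ ξ u) (m u<x)) h eq
    answer₂ : ∀ υ → J.phase n υ ≡ second → Follows J.move υ → Witness E J.move υ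
    answer₂ υ eq fol = inst-witness J.move ξ w (J.extends₂ dis τ≢ eq) (⊆E₂ (lit∈ w) ≢pivot)
      where
      w = answer V₂ υ (extends-follows (move V₂) J.move ξ (J.extends₂ dis τ≢ eq) fol)
      ≢pivot : lit w ≢ mkLit x false (compose τ σ)
      ≢pivot l≡ with w
      ≢pivot refl | witness _ _ _ h m = J.never-second
        (λ u u<x → subst (λ α → Match α (move V₂ u υ)) (lookup-compose τ σ u) (m u<x)) h eq
    answer′ : ∀ υ → Follows J.move υ → Witness E J.move υ
    answer′ υ fol with J.phase n υ in eq
    ... | undecided = contradiction eq (J.decided υ)
    ... | first     = answer₁ υ eq fol
    ... | second    = answer₂ υ eq fol

  irm-step : ∀ {ls E} (st : IRMStep F ls E) (val : Fin (length ls) → Bool) →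
             (∀ {D} (D∈ : D ∈ ls) → val (index D∈) ≡ v → PRefuted D → Valid D) →
             evalFormula (irmFormula {mono = mono} st) a val ≡ v → PRefuted E → Valid E
  irm-step (axiom C C∈ same) val ih eq ref = axiom-valid (axiom-own C∈ {val} eq)
    (λ {z} sP Cz → ref (lit∈E (p-ex z sP) Cz) sP) lit∈E
    where
    lit∈E : ∀ {z b} → quant z ≡ ex → C z ≡ just b → mkLit z b (restrict z (axAnn F C)) ∈ _
    lit∈E {z} {b} q Cz = proj₂ (same _) (z , b , q , Cz , refl)
  irm-step (inst D τ D∈ _ _ same) val ih eq ref =
    inst-valid τ (λ l∈ _ → lit∈E l∈) (ih D∈ eq λ l∈ → ref (lit∈E l∈))
    where
    lit∈E : ∀ {l} → l ∈ D → instLit τ l ∈ _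
    lit∈E {l} l∈ = proj₂ (same _) (l , l∈ , refl)
  irm-step {E = E} (res D₁ D₂ x τ ξ σ D₁∈ D₂∈ _ _ _ _ dis τ≢ same) val ih eq ref =
    resolve (choose x (index D₁∈) (index D₂∈) val eq)
    where
    ⊆E₁ : ∀ {l} → l ∈ D₁ → l ≢ mkLit x true (compose τ ξ) → instLit σ l ∈ E
    ⊆E₁ {l} l∈ l≢ = proj₂ (same _) (inj₁ (l , l∈ , l≢ , refl))
    ⊆E₂ : ∀ {l} → l ∈ D₂ → l ≢ mkLit x false (compose τ σ) → instLit ξ l ∈ E
    ⊆E₂ {l} l∈ l≢ = proj₂ (same _) (inj₂ (l , l∈ , l≢ , refl))
    refuted₁ : (side x ≡ P → Refuted true x) → PRefuted D₁
    refuted₁ r {l} l∈ sP with l ≟ˡ mkLit x true (compose τ ξ)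
    ... | yes refl = r sP
    ... | no l≢    = ref (⊆E₁ l∈ l≢) sP
    refuted₂ : (side x ≡ P → Refuted false x) → PRefuted D₂
    refuted₂ r {l} l∈ sP with l ≟ˡ mkLit x false (compose τ σ)
    ... | yes refl = r sP
    ... | no l≢    = ref (⊆E₂ l∈ l≢) sP
    resolve : Choice x (val (index D₁∈)) (val (index D₂∈)) → Valid E
    resolve (both own eq₁ eq₂) = resolve-valid x τ ξ σ dis τ≢ ⊆E₁ ⊆E₂
      (ih D₁∈ eq₁ (refuted₁ λ sP → contradiction own (P≢ownSide v sP)))
      (ih D₂∈ eq₂ (refuted₂ λ sP → contradiction own (P≢ownSide v sP)))
    -- An own literal differs from the pivot literal, whose variable is not own.
    resolve (left ¬own r eq₁)  =
      inst-valid σ (λ l∈ own → ⊆E₁ l∈ λ { refl → ¬own own }) (ih D₁∈ eq₁ (refuted₁ r))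
    resolve (right ¬own r eq₂) =
      inst-valid ξ (λ l∈ own → ⊆E₂ l∈ λ { refl → ¬own own }) (ih D₂∈ eq₂ (refuted₂ r))
  irm-step {E = E} (merging D b p μ σ D∈ μ∈ σ∈ dom same) val ih eq ref =
    merging-valid b p μ σ dom kept merged (ih D∈ eq refuted)
    where
    kept : ∀ {l} → l ∈ D → l ≢ mkLit b p μ → l ≢ mkLit b p σ → l ∈ E
    kept l∈ l≢μ l≢σ = proj₂ (same _) (inj₁ (l∈ , l≢μ , l≢σ))
    merged : mkLit b p (mergeAnn μ σ) ∈ E
    merged = proj₂ (same _) (inj₂ refl)
    refuted : PRefuted D
    refuted {l} l∈ with l ≟ˡ mkLit b p μ
    ... | yes refl = ref merged
    ... | no l≢μ with l ≟ˡ mkLit b p σ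
    ... | yes refl = ref merged
    ... | no l≢σ   = ref (kept l∈ l≢μ l≢σ)

  irm-valid : ∀ {ls} (d : IRMDeriv F ls) {D} (D∈ : D ∈ ls) →
              evalProgram (irmProgram {mono = mono} d) a (index D∈) ≡ v → PRefuted D → Valid D
  irm-valid (st ∷ d) (here refl) = irm-step st (evalProgram (irmProgram d) a) (irm-valid d)
  irm-valid (st ∷ d) (there D∈)  = irm-valid d D∈

  irm-sound : ∀ {ls} (d : IRMDeriv F ([] ∷ ls)) → evalProgram (irmProgram {mono = mono} d) a zero ≢ v
  irm-sound d eq with following (move V) (move-local V)
    where
    V : Valid []
    V = irm-valid d (here refl) eq λ ()
  ... | υ , fol = absurd (answer (irm-valid d (here refl) eq λ ()) υ fol)
    where
    absurd : ∀ {move υ} → ¬ Witness [] move υ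
    absurd (witness _ () _ _ _)

-- Choice of the mode and assembly of the interpolant

p-positive? : ∀ F → Dec (Instance.p-positive-in-A F)
p-positive? F = All.all? (λ C → all? λ z → (side z ≟ˢ P) →-dec ¬? (maybe-≡-dec _≟ᵇ_ (C z) (just false))) A
  where open Instance F

-- Positivity of p in `A` is decidable, so the procedure can test it and build a program without
-- negations whenever it holds.
mode : Instance → Bool
mode F = does (p-positive? F)

mode-positive : ∀ F → mode F ≡ true → Instance.p-positive-in-A F
mode-positive F eq with p-positive? F
... | yes p = p

-- A true part with index `v` would yield a winning strategy, against which the output cannot be
-- `v`. The size is linear in the number of lines, whence the exponent 1.
interpolates : ∀ F {k} (p : Program F (mode F) (suc k)) → totalCost p ≤ suc k * 6 →
               (∀ {a v} → Winning F a v → evalProgram p a zero ≢ v) →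
               let open Instance F in
               (size (circuit p) ≤ 6 * suc k ^ 1 + 6)
             × InputsIn (λ z → side z ≡ P) (circuit p)
             × (∀ a → output (circuit p) a ≡ false → ¬ A-true a)
             × (∀ a → output (circuit p) a ≡ true  → ¬ B-true a)
             × (p-positive-in-A → Monotone (circuit p))
interpolates F {k} p cost≤ sound =
    size≤
  , circuit-inputs p
  , (λ a eq tr → sound (winning F a false tr) (trans (sym (circuit-output p a)) eq))
  , (λ a eq tr → sound (winning F a true tr) (trans (sym (circuit-output p a)) eq))
  , (λ pos → circuit-monotone (dec-true (p-positive? F) pos) p)
  where
  open ≤-Reasoning
  size≤ : size (circuit p) ≤ 6 * suc k ^ 1 + 6
  size≤ = begin
    size (circuit p)  ≡⟨ circuit-size p ⟩
    -- The single gate added for the output is rounded up to 6.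
    1 + totalCost p   ≤⟨ +-mono-≤ {1} {6} (s≤s z≤n) cost≤ ⟩
    6 + suc k * 6     ≡⟨ +-comm 6 (suc k * 6) ⟩
    suc k * 6 + 6     ≡⟨ cong (_+ 6) (*-comm (suc k) 6) ⟩
    6 * suc k + 6     ≡⟨ cong (λ s → 6 * s + 6) (sym (^-identityʳ (suc k))) ⟩
    6 * suc k ^ 1 + 6 ∎

theorem3p5 : (S : System) → MonotoneFeasibleInterpolation S
theorem3p5 LQU⁺-Res = 6 , 1 , interp , correct
  where
  interp : (F : Instance) → LQRefutation F → Circuit (Instance.n F)
  interp F (_ ∷ _ , d , _) = circuit (lqProgram {mono = mode F} d)
  correct : (F : Instance) (π : LQRefutation F) → _
  correct F (_ ∷ _ , d , D≡∅) = interpolates F (lqProgram d) (lqProgram-cost d)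
    λ W → LQSoundness.lq-sound W (mode-positive F) d D≡∅
theorem3p5 IRM-calc = 6 , 1 , interp , correct
  where
  interp : (F : Instance) → IRMRefutation F → Circuit (Instance.n F)
  interp F (_ ∷ _ , d , _) = circuit (irmProgram {mono = mode F} d)
  correct : (F : Instance) (π : IRMRefutation F) → _
  correct F (_ ∷ _ , d , refl) = interpolates F (irmProgram d) (irmProgram-cost d)
    λ W → IRMSoundness.irm-sound W (mode-positive F) d
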